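{- Let $\mathcal M$ be a first-order structure and let $G$ be a topological group definable in $\mathcal M$ that has a basis of open neighborhoods of $e$ consisting of definable sets (write $G$ for $G(M)$). (i) The space $S_G^\mu(M)$ is compact. There is a topological embedding $\chi\colon G\to S_G^\mu(M)$ such that the image $\chi(G)$ is dense in $S_G^\mu(M)$, and the group multiplication of $G$ extends to a continuous map from $G\times S_G^\mu(M)$ to $S_G^\mu(M)$. (ii) Assume that every type $p\in S_G(M)$ is definable. Then the action of $G$ on $S_G^\mu(M)$ is definably separable. (iii) For any compact $G$-space $C$ and $p\in C$, if the map $g\mapsto g\cdot p$ from $G$ to $C$ is definably separable then it extends uniquely to a continuous $G$-equivariant map from $S_G^\mu(M)$ to $C$.
   Context: $M$ is the universe of $\mathcal M$; "definable" means definable in $\mathcal M$ with parameters from $M$. All topological groups and compact spaces are assumed Hausdorff. A $G$-space is a topological space with a continuous action $G\times C\to C$. $S_G(M)$ is the space of complete types over $M$ containing $x\in G$, with the logic topology. A type $p\in S_G(M)$ is definable if for every formula $\phi(x,y)$ the set $\{a:\phi(x,a)\in p\}$ is definable with parameters from $M$. The infinitesimal type $\mu$ is the partial type over $M$ of all formulas over $M$ defining open neighborhoods of the identity $e$. For $G$-formulas $\varphi,\psi$ over $M$, $\varphi\cdot\psi$ defines $\{ab:\varphi(a),\psi(b)\}$; $\mu\cdot p=\{\varphi\cdot\psi:\mu\vdash\varphi,\ p\vdash\psi\}$. $p\sim_\mu q$ means that $\mu\cdot p$ and $\mu\cdot q$ are logically equivalent; $p_\mu$ is the $\sim_\mu$-class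 of $p$; $S_G^\mu(M)=S_G(M)/{\sim_\mu}$ with the quotient topology. $G$ acts on $S_G^\mu(M)$ by $g\cdot p_\mu=(g\cdot p)_\mu$, where $g\cdot p$ is the left translate of $p$. The embedding $\chi$ is $g\mapsto\mathrm{tp}(g/M)_\mu$, and "extends" in (i) and (iii) is understood after identifying $G$ with $\chi(G)$. A map $f$ from a definable set $D$ to a compact space $C$ is definably separable if for all disjoint closed $C_1,C_2\subseteq C$ the preimages $f^{ -1}(C_1)$ and $f^{ -1}(C_2)$ can be separated by definable subsets of $D$ (there are disjoint definable $D_1,D_2\subseteq D$ with $f^{ -1}(C_i)\subseteq D_i$). An action of $G$ on a compact space $C$ is definably separable if for every $x_0\in C$ the map $g\mapsto g\cdot x_0$ from $G$ to $C$ is definably separable. -}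

module Defs where

open import Algebra.Bundles using (Group)
open import Algebra.Structures using (IsGroup)
open import Axiom.ExcludedMiddle using (ExcludedMiddle)
open import Data.Bool.Base using (Bool; true; false; not; T)
open import Data.Bool.Properties using (T-≡)
import Data.Empty.Polymorphic as ⊥ₚ
open import Data.Fin.Base using (Fin; zero; suc; _↑ˡ_; _↑ʳ_)
open import Data.List.Base as List using (List; []; _∷_)
open import Data.List.Relation.Unary.All as All using (All; []; _∷_)
import Data.List.Relation.Unary.All.Properties as All
open import Data.List.Relation.Unary.Any using (Any)
open import Data.Nat.Base using (ℕ; zero; suc; _+_)
open import Data.Product.Base using (Σ-syntax; ∃; ∃-syntax; ∃₂; _×_; _,_; proj₁; proj₂; uncurry)
open import Data.Product.Relation.Binary.Pointwise.NonDependent using (×-setoid)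
open import Data.Unit.Base using (tt)
open import Data.Vec.Base as Vec using (Vec; []; _∷_; lookup; tabulate; _++_)
import Data.Vec.Properties as Vec
open import Function.Base using (_∘_; id)
open import Function.Bundles using (_⇔_; mk⇔; Equivalence)
open import Function.Definitions using (Congruent; Injective)
open import Level using (Level; _⊔_) renaming (suc to lsuc)
open import Relation.Binary.Bundles using (Setoid)
open import Relation.Binary.Definitions using (_Respects_)
open import Relation.Binary.PropositionalEquality
  using (_≡_; refl; sym; trans; cong; cong₂; subst; isEquivalence)
import Relation.Binary.Construct.On as On
open import Relation.Nullary.Decidable using (Dec; yes; no; does; dec-true; dec-false)
open import Relation.Nullary.Negation using (¬_; contradiction)
open import Relation.Unary using (Pred; ∁; ⋃; _∩_; _⊆_; _⊥_; _≐_)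

record Topology {ℓ} (X : Setoid ℓ ℓ) (o : Level) : Set (lsuc (ℓ ⊔ o)) where
  open Setoid X using (Carrier; _≈_)
  field
    IsOpen      : Pred Carrier ℓ → Set o
    open-resp-≈ : ∀ {V} → IsOpen V → V Respects _≈_
    open-resp-≐ : ∀ {V W} → V ≐ W → IsOpen V → IsOpen W
    open-U      : IsOpen (λ x → x ≈ x)
    open-∩      : ∀ {V W} → IsOpen V → IsOpen W → IsOpen (V ∩ W)
    open-⋃      : ∀ {I : Set ℓ} {V : I → Pred Carrier ℓ} →
                  (∀ i → IsOpen (V i)) → IsOpen (⋃ I V)

  IsClosed : Pred Carrier ℓ → Set o
  IsClosed V = IsOpen (∁ V)

  Hausdorff : Set (lsuc ℓ ⊔ o)
  Hausdorff = ∀ x y → ¬ x ≈ y →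
    ∃₂ λ V W → IsOpen V × V x × IsOpen W × W y × V ⊥ W

  Dense : ∀ {a} {A : Set a} → (A → Carrier) → Set (a ⊔ lsuc ℓ ⊔ o)
  Dense f = ∀ V → IsOpen V → ∃ V → ∃[ a ] V (f a)

  -- The Hausdorff separation axiom is part of compactness.
  record IsCompact : Set (lsuc ℓ ⊔ o) where
    field
      hausdorff      : Hausdorff
      finiteSubcover : ∀ {I : Set ℓ} (V : I → Pred Carrier ℓ) →
                       (∀ i → IsOpen (V i)) → (∀ x → ∃[ i ] V i x) →
                       Σ[ is ∈ List I ] (∀ x → Any (λ i → V i x) is)

module _ {ℓ o₁ o₂} {X Y : Setoid ℓ ℓ} (TX : Topology X o₁) (TY : Topology Y o₂) where
  private
    module X = Setoid X
    module Y = Setoid Y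
    module TX = Topology TX
    module TY = Topology TY

  Continuous : (X.Carrier → Y.Carrier) → Set (lsuc ℓ ⊔ o₁ ⊔ o₂)
  Continuous f = ∀ V → TY.IsOpen V → TX.IsOpen (V ∘ f)

  record IsEmbedding (f : X.Carrier → Y.Carrier) : Set (lsuc ℓ ⊔ o₁ ⊔ o₂) where
    field
      congruent  : Congruent X._≈_ Y._≈_ f
      injective  : Injective X._≈_ Y._≈_ f
      continuous : Continuous f
      initial    : ∀ V → TX.IsOpen V → ∃[ W ] TY.IsOpen W × V ≐ (W ∘ f)

  productTopology : Topology (×-setoid X Y) (lsuc ℓ ⊔ o₁ ⊔ o₂)
  productTopology = record
    { IsOpen      = λ W → ∀ x y → W (x , y) → Box W x y
    ; open-resp-≈ = λ {W} W-open {(x , y)} (x≈x′ , y≈y′) w →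
        let (V₁ , V₂ , o₁ , v₁ , o₂ , v₂ , sub) = W-open x y w in
        sub (TX.open-resp-≈ o₁ x≈x′ v₁) (TY.open-resp-≈ o₂ y≈y′ v₂)
    ; open-resp-≐ = λ (V⊆W , W⊆V) V-open x y w → widen V⊆W (V-open x y (W⊆V w))
    ; open-U      = λ x y _ → _ , _ , TX.open-U , X.refl , TY.open-U , Y.refl ,
        λ _ _ → X.refl , Y.refl
    ; open-∩      = λ V-open W-open x y (v , w) →
        let (V₁ , V₂ , o₁ , v₁ , o₂ , v₂ , sub)   = V-open x y v
            (W₁ , W₂ , o₁′ , w₁ , o₂′ , w₂ , sub′) = W-open x y w
        in V₁ ∩ W₁ , V₂ ∩ W₂ , TX.open-∩ o₁ o₁′ , (v₁ , w₁) ,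
           TY.open-∩ o₂ o₂′ , (v₂ , w₂) ,
           λ (a , a′) (b , b′) → sub a b , sub′ a′ b′
    ; open-⋃      = λ V-open x y (i , v) → widen (i ,_) (V-open i x y v)
    }
    where
    Box : Pred (X.Carrier × Y.Carrier) ℓ → X.Carrier → Y.Carrier → Set (lsuc ℓ ⊔ o₁ ⊔ o₂)
    Box W x y = Σ[ V₁ ∈ Pred X.Carrier ℓ ] Σ[ V₂ ∈ Pred Y.Carrier ℓ ]
      TX.IsOpen V₁ × V₁ x × TY.IsOpen V₂ × V₂ y ×
      (∀ {x′ y′} → V₁ x′ → V₂ y′ → W (x′ , y′))

    widen : ∀ {V W x y} → V ⊆ W → Box V x y → Box W x y
    widen V⊆W (V₁ , V₂ , o₁ , v₁ , o₂ , v₂ , sub) =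
      V₁ , V₂ , o₁ , v₁ , o₂ , v₂ , λ a b → V⊆W (sub a b)

record TopologicalGroup (ℓ : Level) : Set (lsuc ℓ) where
  field
    group    : Group ℓ ℓ
  open Group group public
  field
    topology      : Topology setoid ℓ
    hausdorff     : Topology.Hausdorff topology
    ∙-continuous  : Continuous (productTopology topology topology) topology (uncurry _∙_)
    ⁻¹-continuous : Continuous topology topology _⁻¹

record IsGSpace {ℓ o} (G : TopologicalGroup ℓ) {X : Setoid ℓ ℓ} (TX : Topology X o)
                (_•_ : TopologicalGroup.Carrier G → Setoid.Carrier X → Setoid.Carrier X)
                : Set (lsuc ℓ ⊔ o) where
  private
    module G = TopologicalGroup G
    module X = Setoid X
  field
    •-cong     : ∀ {g h x y} → g G.≈ h → x X.≈ y → (g • x) X.≈ (h • y)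
    identity   : ∀ x → (G.ε • x) X.≈ x
    assoc      : ∀ g h x → ((g G.∙ h) • x) X.≈ (g • (h • x))
    continuous : Continuous (productTopology G.topology TX) TX (uncurry _•_)

record Language (ℓ : Level) : Set (lsuc ℓ) where
  field
    Fun : ℕ → Set ℓ
    Rel : ℕ → Set ℓ

record Structure {ℓ} (L : Language ℓ) : Set (lsuc ℓ) where
  open Language L
  field
    Universe : Set ℓ
    ⟦_⟧ᶠ     : ∀ {k} → Fun k → Vec Universe k → Universe
    ⟦_⟧ʳ     : ∀ {k} → Rel k → Pred (Vec Universe k) ℓ

module _ {ℓ} (L : Language ℓ) (P : Set ℓ) where
  open Language L

  -- Terms and formulas of L with parameters from P, in n free variables.
  data Term (n : ℕ) : Set ℓ where
    var : Fin n → Term n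
    par : P → Term n
    fun : ∀ {k} → Fun k → (Fin k → Term n) → Term n

  infix  7 _==_
  infixr 6 _∧′_
  infix  8 ¬′_ ∃′_

  -- ∃′ binds variable zero.
  data Formula : ℕ → Set ℓ where
    _==_ : ∀ {n} → Term n → Term n → Formula n
    rel  : ∀ {n k} → Rel k → (Fin k → Term n) → Formula n
    ¬′_  : ∀ {n} → Formula n → Formula n
    _∧′_ : ∀ {n} → Formula n → Formula n → Formula n
    ∃′_  : ∀ {n} → Formula (suc n) → Formula n

module _ {ℓ} {L : Language ℓ} where

  private variable
    P Q : Set ℓ
    m n : ℕ

  substᵗ : (P → Q) → Vec (Term L Q m) n → Term L P n → Term L Q m
  substᵗ τ σ (var i)    = lookup σ i
  substᵗ τ σ (par c)    = par (τ c)
  substᵗ τ σ (fun f ts) = fun f (λ i → substᵗ τ σ (ts i))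

  vars : ∀ n → Vec (Term L P n) n
  vars n = tabulate var

  weaken : Term L P n → Term L P (suc n)
  weaken {n = n} = substᵗ id (tabulate {n = n} (λ i → var (suc i)))

  substᶠ : (P → Q) → Vec (Term L Q m) n → Formula L P n → Formula L Q m
  substᶠ τ σ (t == u)   = substᵗ τ σ t == substᵗ τ σ u
  substᶠ τ σ (rel R ts) = rel R (λ i → substᵗ τ σ (ts i))
  substᶠ τ σ (¬′ φ)     = ¬′ substᶠ τ σ φ
  substᶠ τ σ (φ ∧′ ψ)   = substᶠ τ σ φ ∧′ substᶠ τ σ ψ
  substᶠ τ σ (∃′ φ)     = ∃′ substᶠ τ (var zero ∷ Vec.map weaken σ) φ

  ∃ⁿ : ∀ n → Formula L P (n + m) → Formula L P m
  ∃ⁿ zero    φ = φ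
  ∃ⁿ (suc n) φ = ∃ⁿ n (∃′ φ)

module FirstOrder {ℓ} {L : Language ℓ} (𝓜 : Structure L) where
  open Structure 𝓜 renaming (Universe to M)

  private variable
    m n k : ℕ

  Formulaᴹ : ℕ → Set ℓ
  Formulaᴹ = Formula L M

  eval : Vec M n → Term L M n → M
  eval v (var i)    = lookup v i
  eval v (par c)    = c
  eval v (fun f ts) = ⟦ f ⟧ᶠ (tabulate (λ i → eval v (ts i)))

  infix 4 _⊨_
  _⊨_ : Vec M n → Formulaᴹ n → Set ℓ
  v ⊨ (t == u)   = eval v t ≡ eval v u
  v ⊨ rel R ts   = ⟦ R ⟧ʳ (tabulate (λ i → eval v (ts i)))
  v ⊨ (¬′ φ)     = ¬ (v ⊨ φ)
  v ⊨ (φ ∧′ ψ)   = v ⊨ φ × v ⊨ ψ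
  v ⊨ (∃′ φ)     = Σ[ a ∈ M ] (a ∷ v) ⊨ φ

  eval-subst : (v : Vec M m) (σ : Vec (Term L M m) n) (t : Term L M n) →
               eval v (substᵗ id σ t) ≡ eval (Vec.map (eval v) σ) t
  eval-subst v σ (var i)    = sym (Vec.lookup-map i (eval v) σ)
  eval-subst v σ (par c)    = refl
  eval-subst v σ (fun f ts) = cong ⟦ f ⟧ᶠ (Vec.tabulate-cong (λ i → eval-subst v σ (ts i)))

  eval-weaken : (a : M) (v : Vec M n) (t : Term L M n) → eval (a ∷ v) (weaken t) ≡ eval v t
  eval-weaken a v t = trans (eval-subst (a ∷ v) _ t)
    (cong (λ w → eval w t)
      (trans (sym (Vec.tabulate-∘ (eval (a ∷ v)) _)) (Vec.tabulate∘lookup v)))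

  ⊨-subst : (v : Vec M m) (σ : Vec (Term L M m) n) (φ : Formulaᴹ n) →
            (v ⊨ substᶠ id σ φ) ⇔ (Vec.map (eval v) σ ⊨ φ)
  ⊨-subst v σ (t == u) = mk⇔
    (λ e → trans (sym (eval-subst v σ t)) (trans e (eval-subst v σ u)))
    (λ e → trans (eval-subst v σ t) (trans e (sym (eval-subst v σ u))))
  ⊨-subst v σ (rel R ts) = mk⇔ (subst ⟦ R ⟧ʳ eq) (subst ⟦ R ⟧ʳ (sym eq))
    where eq = Vec.tabulate-cong (λ i → eval-subst v σ (ts i))
  ⊨-subst v σ (¬′ φ) = mk⇔ (λ nφ s → nφ (from s)) (λ nφ s → nφ (to s))
    where open Equivalence (⊨-subst v σ φ)
  ⊨-subst v σ (φ ∧′ ψ) = mk⇔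
    (λ (s , t) → Equivalence.to (⊨-subst v σ φ) s , Equivalence.to (⊨-subst v σ ψ) t)
    (λ (s , t) → Equivalence.from (⊨-subst v σ φ) s , Equivalence.from (⊨-subst v σ ψ) t)
  ⊨-subst v σ (∃′ φ) = mk⇔
    (λ (a , s) → a , subst (λ w → a ∷ w ⊨ φ) (eq a) (Equivalence.to (ih a) s))
    (λ (a , s) → a , Equivalence.from (ih a) (subst (λ w → a ∷ w ⊨ φ) (sym (eq a)) s))
    where
    ih = λ a → ⊨-subst (a ∷ v) (var zero ∷ Vec.map weaken σ) φ
    eq : ∀ a → Vec.map (eval (a ∷ v)) (Vec.map weaken σ) ≡ Vec.map (eval v) σ
    eq a = trans (sym (Vec.map-∘ _ _ σ)) (Vec.map-cong (eval-weaken a v) σ)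

  ⊨-∃ⁿ : ∀ n (v : Vec M m) (φ : Formulaᴹ (n + m)) →
         (v ⊨ ∃ⁿ n φ) ⇔ (Σ[ w ∈ Vec M n ] (w ++ v ⊨ φ))
  ⊨-∃ⁿ zero    v φ = mk⇔ (λ s → [] , s) (λ { ([] , s) → s })
  ⊨-∃ⁿ (suc n) v φ = mk⇔
    (λ s → let (w , a , t) = to s in a ∷ w , t)
    (λ { (a ∷ w , t) → from (w , a , t) })
    where open Equivalence (⊨-∃ⁿ n v (∃′ φ))

  Points : Formulaᴹ n → Setoid ℓ ℓ
  Points {n} δ = record
    { Carrier       = Σ[ v ∈ Vec M n ] v ⊨ δ
    ; _≈_           = λ a b → proj₁ a ≡ proj₁ b
    ; isEquivalence = On.isEquivalence proj₁ isEquivalence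
    }

  Defines : ∀ {a} → Formulaᴹ n → Pred (Vec M n) a → Set (ℓ ⊔ a)
  Defines φ D = ∀ v → (v ⊨ φ) ⇔ D v

  Definable : ∀ {a} → Pred (Vec M n) a → Set (ℓ ⊔ a)
  Definable D = ∃[ φ ] Defines φ D

  DefinableSubset : (δ : Formulaᴹ n) → Pred (Setoid.Carrier (Points δ)) ℓ → Set ℓ
  DefinableSubset δ D = ∃[ φ ] (∀ a → (proj₁ a ⊨ φ) ⇔ D a)

  DefinablySeparable : ∀ {o} (δ : Formulaᴹ n) {C : Setoid ℓ ℓ} (TC : Topology C o) →
                       (Setoid.Carrier (Points δ) → Setoid.Carrier C) → Set (lsuc ℓ ⊔ o)
  DefinablySeparable δ TC f = ∀ C₁ C₂ → IsClosed C₁ → IsClosed C₂ → C₁ ⊥ C₂ →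
    ∃₂ λ D₁ D₂ → DefinableSubset δ D₁ × DefinableSubset δ D₂ × D₁ ⊥ D₂ ×
                 (C₁ ∘ f) ⊆ D₁ × (C₂ ∘ f) ⊆ D₂
    where open Topology TC

  -- Consequence modulo the elementary diagram of 𝓜: derivations use finitely
  -- many premises, and that diagram is a complete theory.
  infix 4 _⊢_
  record _⊢_ {a} (Γ : Pred (Formulaᴹ n) a) (θ : Formulaᴹ n) : Set (ℓ ⊔ a) where
    constructor derive
    field
      premises   : List (Formulaᴹ n)
      premises⊆Γ : All Γ premises
      implies    : ∀ v → All (v ⊨_) premises → v ⊨ θ

  LogicallyEquivalent : ∀ {a b} → Pred (Formulaᴹ n) a → Pred (Formulaᴹ n) b → Set (ℓ ⊔ a ⊔ b)
  LogicallyEquivalent Γ Δ = (∀ {θ} → Δ θ → Γ ⊢ θ) × (∀ {θ} → Γ θ → Δ ⊢ θ)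

  ⊢-axiom : ∀ {a} {Γ : Pred (Formulaᴹ n) a} {θ} → Γ θ → Γ ⊢ θ
  ⊢-axiom {θ = θ} θ∈Γ = derive (θ ∷ []) (θ∈Γ ∷ []) λ { v (s ∷ []) → s }

  ⊢-cut : ∀ {a b} {Γ : Pred (Formulaᴹ n) a} {Δ : Pred (Formulaᴹ n) b} →
          (∀ {θ} → Δ θ → Γ ⊢ θ) → ∀ {θ} → Δ ⊢ θ → Γ ⊢ θ
  ⊢-cut {Γ = Γ} {Δ} Γ⊢Δ (derive φs φs⊆Δ imp) =
    let (ψs , ψs⊆Γ , imp′) = collect φs⊆Δ in derive ψs ψs⊆Γ λ v s → imp v (imp′ v s)
    where
    collect : ∀ {φs} → All Δ φs → Σ[ ψs ∈ List (Formulaᴹ _) ] All Γ ψs ×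
              (∀ v → All (v ⊨_) ψs → All (v ⊨_) φs)
    collect []       = [] , [] , λ _ _ → []
    collect (δ ∷ δs) =
      let (derive ψs ψs⊆Γ i) = Γ⊢Δ δ
          (χs , χs⊆Γ , j) = collect δs
      in ψs List.++ χs , All.++⁺ ψs⊆Γ χs⊆Γ ,
         λ v s → i v (All.++⁻ˡ ψs s) ∷ j v (All.++⁻ʳ ψs s)

  -- Complete types over M concentrated on δ: maximal finitely satisfiable sets
  -- of formulas over M.  They are given by characteristic functions, which
  -- keeps the type space in the universe of 𝓜.
  record CompleteType (δ : Formulaᴹ n) : Set ℓ where
    field
      mem      : Formulaᴹ n → Bool
      complete : ∀ φ → mem (¬′ φ) ≡ not (mem φ)
      finsat   : ∀ φs → All (T ∘ mem) φs → ∃[ v ] All (v ⊨_) φs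
      mem-δ    : T (mem δ)

  open CompleteType using (mem)

  infix 4 _∋_
  _∋_ : {δ : Formulaᴹ n} → CompleteType δ → Pred (Formulaᴹ n) Level.zero
  p ∋ φ = T (mem p φ)

  module _ {δ : Formulaᴹ n} (p : CompleteType δ) where
    open CompleteType p using (complete; finsat)

    ∌⇒∋¬ : ∀ φ → mem p φ ≡ false → p ∋ (¬′ φ)
    ∌⇒∋¬ φ e = subst T (sym (trans (complete φ) (cong not e))) tt

    inconsistent : ∀ φs → All (p ∋_) φs → ¬ (∃[ v ] All (v ⊨_) φs) → ∀ {b} {B : Set b} → B
    inconsistent φs φs⊆p ns = contradiction (finsat φs φs⊆p) ns

    ∋-∧ : ∀ {φ ψ} → p ∋ φ → p ∋ ψ → p ∋ (φ ∧′ ψ)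
    ∋-∧ {φ} {ψ} pφ pψ with mem p (φ ∧′ ψ) in e
    ... | true  = tt
    ... | false = inconsistent (φ ∷ ψ ∷ ¬′ (φ ∧′ ψ) ∷ []) (pφ ∷ pψ ∷ ∌⇒∋¬ _ e ∷ [])
                    λ { (v , s ∷ t ∷ u ∷ []) → u (s , t) }

    ∧-∋ˡ : ∀ {φ ψ} → p ∋ (φ ∧′ ψ) → p ∋ φ
    ∧-∋ˡ {φ} {ψ} pφψ with mem p φ in e
    ... | true  = tt
    ... | false = inconsistent (φ ∧′ ψ ∷ ¬′ φ ∷ []) (pφψ ∷ ∌⇒∋¬ _ e ∷ [])
                    λ { (v , (s , _) ∷ u ∷ []) → u s }

    ∧-∋ʳ : ∀ {φ ψ} → p ∋ (φ ∧′ ψ) → p ∋ ψ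
    ∧-∋ʳ {φ} {ψ} pφψ with mem p ψ in e
    ... | true  = tt
    ... | false = inconsistent (φ ∧′ ψ ∷ ¬′ ψ ∷ []) (pφψ ∷ ∌⇒∋¬ _ e ∷ [])
                    λ { (v , (_ , s) ∷ u ∷ []) → u s }

  -- {a ∈ Mᵏ : φ(x,a) ∈ p} is definable for every parameter-free φ(x,y).
  IsDefinableType : {δ : Formulaᴹ n} → CompleteType δ → Set ℓ
  IsDefinableType {n} p = ∀ {k} (φ : Formula L ⊥ₚ.⊥ (n + k)) →
    Definable {k} (λ a → p ∋ (substᶠ ⊥ₚ.⊥-elim (vars n ++ Vec.map par a) φ))

  TypeSetoid : Formulaᴹ n → Setoid ℓ ℓ
  TypeSetoid δ = record
    { Carrier       = CompleteType δ
    ; _≈_           = λ p q → ∀ φ → mem p φ ≡ mem q φ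
    ; isEquivalence = record
      { refl  = λ _ → refl
      ; sym   = λ e φ → sym (e φ)
      ; trans = λ e e′ φ → trans (e φ) (e′ φ)
      }
    }

  logicTopology : (δ : Formulaᴹ n) → Topology (TypeSetoid δ) ℓ
  logicTopology δ = record
    { IsOpen      = λ V → ∀ p → V p → ∃[ φ ] p ∋ φ × (∀ {q} → q ∋ φ → V q)
    ; open-resp-≈ = λ V-open {p} p≈q v →
        let (φ , pφ , sub) = V-open p v in sub (subst T (p≈q φ) pφ)
    ; open-resp-≐ = λ (V⊆W , W⊆V) V-open p w →
        let (φ , pφ , sub) = V-open p (W⊆V w) in φ , pφ , λ qφ → V⊆W (sub qφ)
    ; open-U      = λ p _ → δ , CompleteType.mem-δ p , λ _ _ → refl
    ; open-∩      = λ V-open W-open p (v , w) →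
        let (φ , pφ , sub)  = V-open p v
            (ψ , pψ , sub′) = W-open p w
        in φ ∧′ ψ , ∋-∧ p pφ pψ , λ {q} qφψ → sub (∧-∋ˡ q qφψ) , sub′ (∧-∋ʳ q qφψ)
    ; open-⋃      = λ V-open p (i , v) →
        let (φ , pφ , sub) = V-open i p v in φ , pφ , λ qφ → i , sub qφ
    }

  tp : ExcludedMiddle ℓ → {δ : Formulaᴹ n} → Setoid.Carrier (Points δ) → CompleteType δ
  tp {n} lem {δ} (a , a⊨δ) = record
    { mem      = λ φ → does (dec φ)
    ; complete = compl
    ; finsat   = λ φs s → a , All.map (λ {φ} → sound φ) s
    ; mem-δ    = subst T (sym (dec-true (dec δ) a⊨δ)) tt
    }
    where
    dec : (φ : Formulaᴹ n) → Dec (a ⊨ φ)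
    dec φ = lem

    sound : ∀ φ → T (does (dec φ)) → a ⊨ φ
    sound φ t with dec φ
    ... | yes s = s

    compl : ∀ φ → does (dec (¬′ φ)) ≡ not (does (dec φ))
    compl φ with dec φ
    ... | yes s = dec-false (dec (¬′ φ)) (λ ns → ns s)
    ... | no ns = dec-true (dec (¬′ φ)) ns

record DefinableTopologicalGroup {ℓ} {L : Language ℓ} (𝓜 : Structure L) : Set (lsuc ℓ) where
  open Structure 𝓜 renaming (Universe to M)
  open FirstOrder 𝓜
  field
    dim : ℕ
    γ   : Formulaᴹ dim
  open Setoid (Points γ) public using (Carrier; _≈_)
  field
    _∙_     : Carrier → Carrier → Carrier
    ε       : Carrier
    _⁻¹     : Carrier → Carrier
    isGroup : IsGroup _≈_ _∙_ ε _⁻¹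
    mulᶠ    : Formulaᴹ (dim + (dim + dim))
    mulᶠ-defines-∙ : ∀ a b c →
      (proj₁ a ++ (proj₁ b ++ proj₁ c) ⊨ mulᶠ) ⇔ ((a ∙ b) ≈ c)

  group : Group ℓ ℓ
  group = record { isGroup = isGroup }

  field
    topology      : Topology (Group.setoid group) ℓ
  open Topology topology public using (IsOpen)
  field
    hausdorff     : Topology.Hausdorff topology
    ∙-continuous  : Continuous (productTopology topology topology) topology (uncurry _∙_)
    ⁻¹-continuous : Continuous topology topology _⁻¹
    definableBasis : ∀ V → IsOpen V → V ε →
      ∃[ W ] DefinableSubset γ W × IsOpen W × W ε × W ⊆ V

  topologicalGroup : TopologicalGroup ℓ
  topologicalGroup = record
    { group         = group
    ; topology      = topology
    ; hausdorff     = hausdorff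
    ; ∙-continuous  = ∙-continuous
    ; ⁻¹-continuous = ⁻¹-continuous
    }

module μTypes {ℓ} {L : Language ℓ} {𝓜 : Structure L} (G : DefinableTopologicalGroup 𝓜) where
  open Structure 𝓜 renaming (Universe to M)
  open FirstOrder 𝓜
  open DefinableTopologicalGroup G
  open CompleteType using (mem; finsat; mem-δ)
  open Equivalence using (to; from)

  IsGFormula : Formulaᴹ dim → Set ℓ
  IsGFormula φ = ∀ v → v ⊨ φ → v ⊨ γ

  μ : Pred (Formulaᴹ dim) ℓ
  μ φ = IsGFormula φ × IsOpen (λ g → proj₁ g ⊨ φ) × proj₁ ε ⊨ φ

  DefinesProduct : Formulaᴹ dim → Formulaᴹ dim → Formulaᴹ dim → Set ℓ
  DefinesProduct φ ψ θ = Defines θ λ v →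
    ∃₂ λ a b → proj₁ a ⊨ φ × proj₁ b ⊨ ψ × v ≡ proj₁ (a ∙ b)

  -- The partial type μ·p; θ ranges over all formulas defining the set φ·ψ.
  μ·_ : CompleteType γ → Pred (Formulaᴹ dim) ℓ
  (μ· p) θ = ∃₂ λ φ ψ → IsGFormula φ × IsGFormula ψ ×
    (μ ⊢ φ) × ((p ∋_) ⊢ ψ) × DefinesProduct φ ψ θ

  infix 4 _∼μ_
  record _∼μ_ (p q : CompleteType γ) : Set ℓ where
    constructor mk∼μ
    field
      equivalent : LogicallyEquivalent (μ· p) (μ· q)

  -- The space S^μ_G(M): the quotient of the type space is the same carrier
  -- with equality ∼μ, so its open sets are the ∼μ-invariant open sets.
  μTypeSetoid : Setoid ℓ ℓ
  μTypeSetoid = record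
    { Carrier       = CompleteType γ
    ; _≈_           = _∼μ_
    ; isEquivalence = record
      { refl  = λ {p} → mk∼μ (⊢-axiom {Γ = μ· p} , ⊢-axiom {Γ = μ· p})
      ; sym   = λ (mk∼μ (f , b)) → mk∼μ (b , f)
      ; trans = λ {p} {q} {r} (mk∼μ (f , b)) (mk∼μ (f′ , b′)) → mk∼μ
          ( (λ θ∈ → ⊢-cut {Γ = μ· p} {Δ = μ· q} f (f′ θ∈))
          , (λ θ∈ → ⊢-cut {Γ = μ· r} {Δ = μ· q} b′ (b θ∈)))
      }
    }

  μTypeTopology : Topology μTypeSetoid ℓ
  μTypeTopology = record
    { IsOpen      = λ V → V Respects _∼μ_ × T.IsOpen V
    ; open-resp-≈ = proj₁
    ; open-resp-≐ = λ { {V} {W} (V⊆W , W⊆V) (r , o) →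
        (λ e w → V⊆W (r e (W⊆V w))) , T.open-resp-≐ {V} {W} (V⊆W , W⊆V) o }
    ; open-U      = (λ { {x} {y} _ _ → S.refl {y} }) ,
        λ p _ → γ , mem-δ p , λ {q} _ → S.refl {q}
    ; open-∩      = λ { {V} {W} (r , o) (r′ , o′) →
        (λ e (v , w) → r e v , r′ e w) , T.open-∩ {V} {W} o o′ }
    ; open-⋃      = λ { {I} {V} os →
        (λ e (i , v) → i , proj₁ (os i) e v) , T.open-⋃ {I} {V} (λ i → proj₂ (os i)) }
    }
    where
    module T = Topology (logicTopology γ)
    module S = Setoid μTypeSetoid

  χ : ExcludedMiddle ℓ → Carrier → CompleteType γ
  χ lem g = tp lem g

  private
    xs ys : Vec (Term L M (dim + dim)) dim
    xs = tabulate (λ i → var (dim ↑ʳ i))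
    ys = tabulate (λ i → var (i ↑ˡ dim))

    eval-xs : ∀ w v → Vec.map (eval (w ++ v)) xs ≡ v
    eval-xs w v = trans (sym (Vec.tabulate-∘ _ _))
      (trans (Vec.tabulate-cong (Vec.lookup-++ʳ w v)) (Vec.tabulate∘lookup v))

    eval-ys : ∀ w v → Vec.map (eval (w ++ v)) ys ≡ w
    eval-ys w v = trans (sym (Vec.tabulate-∘ _ _))
      (trans (Vec.tabulate-cong (Vec.lookup-++ˡ w v)) (Vec.tabulate∘lookup w))

    eval-par : ∀ {m n} (v : Vec M m) (a : Vec M n) → Vec.map (eval v) (Vec.map par a) ≡ a
    eval-par v a = trans (sym (Vec.map-∘ _ _ a)) (Vec.map-id a)

    eval-gxy : ∀ (g w v : Vec M dim) →
      Vec.map (eval (w ++ v)) (Vec.map par g ++ (xs ++ ys)) ≡ g ++ (v ++ w)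
    eval-gxy g w v = trans (Vec.map-++ _ (Vec.map par g) (xs ++ ys))
      (cong₂ _++_ (eval-par (w ++ v) g)
        (trans (Vec.map-++ _ xs ys) (cong₂ _++_ (eval-xs w v) (eval-ys w v))))

  -- φ(g·x), that is, ∃ y (y ∈ G ∧ g·x = y ∧ φ(y)).
  translate : Carrier → Formulaᴹ dim → Formulaᴹ dim
  translate g φ = ∃ⁿ dim
    (substᶠ id ys γ ∧′ substᶠ id (Vec.map par (proj₁ g) ++ (xs ++ ys)) mulᶠ ∧′ substᶠ id ys φ)

  ⊨-translate : ∀ g x φ → (proj₁ x ⊨ translate g φ) ⇔ (proj₁ (g ∙ x) ⊨ φ)
  ⊨-translate g x@(v , _) φ = mk⇔ there back
    where
    there : (v ⊨ translate g φ) → proj₁ (g ∙ x) ⊨ φ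
    there s =
      let (w , s₁ , s₂ , s₃) = to (⊨-∃ⁿ dim v _) s
          t₁ = subst (λ u → u ⊨ γ) (eval-ys w v) (to (⊨-subst _ ys γ) s₁)
          t₂ = subst (λ u → u ⊨ mulᶠ) (eval-gxy (proj₁ g) w v) (to (⊨-subst _ _ mulᶠ) s₂)
          t₃ = subst (λ u → u ⊨ φ) (eval-ys w v) (to (⊨-subst _ ys φ) s₃)
      in subst (λ u → u ⊨ φ) (sym (to (mulᶠ-defines-∙ g x (w , t₁)) t₂)) t₃

    back : proj₁ (g ∙ x) ⊨ φ → v ⊨ translate g φ
    back s = from (⊨-∃ⁿ dim v _) (w ,
      from (⊨-subst _ ys γ)
        (subst (λ u → u ⊨ γ) (sym (eval-ys w v)) (proj₂ (g ∙ x))) ,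
      from (⊨-subst _ _ mulᶠ)
        (subst (λ u → u ⊨ mulᶠ) (sym (eval-gxy (proj₁ g) w v))
          (from (mulᶠ-defines-∙ g x (g ∙ x)) refl)) ,
      from (⊨-subst _ ys φ) (subst (λ u → u ⊨ φ) (sym (eval-ys w v)) s))
      where w = proj₁ (g ∙ x)

  -- The left translate g·p = {φ : φ(g·x) ∈ p}.
  infixr 7 _•_
  _•_ : Carrier → CompleteType γ → CompleteType γ
  g • p = record
    { mem      = mem p ∘ translate g
    ; complete = compl
    ; finsat   = sat
    ; mem-δ    = γ∈gp
    }
    where
    compl : ∀ φ → mem p (translate g (¬′ φ)) ≡ not (mem p (translate g φ))
    compl φ with mem p (translate g (¬′ φ)) in e | mem p (translate g φ) in e′
    ... | true  | false = refl
    ... | false | true  = refl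
    ... | true  | true  = inconsistent p (γ ∷ translate g (¬′ φ) ∷ translate g φ ∷ [])
      (mem-δ p ∷ from T-≡ e ∷ from T-≡ e′ ∷ [])
      λ { (v , s ∷ t ∷ u ∷ []) →
          to (⊨-translate g (v , s) (¬′ φ)) t (to (⊨-translate g (v , s) φ) u) }
    ... | false | false = inconsistent p (γ ∷ ¬′ translate g (¬′ φ) ∷ ¬′ translate g φ ∷ [])
      (mem-δ p ∷ ∌⇒∋¬ p _ e ∷ ∌⇒∋¬ p _ e′ ∷ [])
      λ { (v , s ∷ t ∷ u ∷ []) →
          t (from (⊨-translate g (v , s) (¬′ φ)) (λ r → u (from (⊨-translate g (v , s) φ) r))) }

    sat : ∀ φs → All (λ φ → T (mem p (translate g φ))) φs → ∃[ v ] All (v ⊨_) φs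
    sat φs s with finsat p (γ ∷ List.map (translate g) φs) (mem-δ p ∷ All.map⁺ s)
    ... | v , v⊨γ ∷ t = proj₁ (g ∙ (v , v⊨γ)) ,
                        All.map (λ {φ} → to (⊨-translate g (v , v⊨γ) φ)) (All.map⁻ t)

    γ∈gp : T (mem p (translate g γ))
    γ∈gp with mem p (translate g γ) in e
    ... | true  = tt
    ... | false = inconsistent p (γ ∷ ¬′ translate g γ ∷ []) (mem-δ p ∷ ∌⇒∋¬ p _ e ∷ [])
      λ { (v , s ∷ t ∷ []) → t (from (⊨-translate g (v , s) γ) (proj₂ (g ∙ (v , s)))) }

  DefinablySeparableAction : ∀ {o} {C : Setoid ℓ ℓ} (TC : Topology C o) →
    (Carrier → Setoid.Carrier C → Setoid.Carrier C) → Set (lsuc ℓ ⊔ o)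
  DefinablySeparableAction TC _·_ = ∀ x₀ → DefinablySeparable γ TC (λ g → g · x₀)

{-# OPTIONS --safe #-}
module Submission where

-- Excluded middle for all types yields choice functions, hence a Teichmüller–Tukey lemma, the
-- extension of finitely satisfiable sets to complete types, and compactness of the type space.
-- For types p, q, p ∼μ q holds iff U·ψ meets θ for all U in μ, ψ in p and θ in q.  The sets
-- {r : μ·r ⊢ A} are then open and ∼μ-invariant, and by compactness they form a basis of the
-- quotient; the Hausdorff property, the embedding and joint continuity are computed with them.
-- For (ii), disjoint closed sets of types are separated by a formula θ, and {g : θ ∈ g·p} is
-- definable because p is.  For (iii), the orbit map has along every type q a cluster point by
-- compactness; definable separability makes it a limit, so it is unique and depends continuously
-- on q, and continuity of the action at (ε , c) shows that it only depends on the ∼μ-class of q.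

open import Defs
import Algebra.Properties.Group as GroupProperties
open import Algebra.Bundles using (Group)
open import Axiom.ExcludedMiddle using (ExcludedMiddle)
open import Axiom.Extensionality.Propositional using (Extensionality)
open import Data.Bool.Base using (Bool; true; false; _∨_; not; T)
open import Data.Bool.Properties using (T-∨; T-≡; T?)
import Data.Empty.Polymorphic as ⊥ₚ
open import Data.Fin.Base as Fin using (Fin; zero; suc; _↑ˡ_; _↑ʳ_; splitAt)
open import Data.List.Base as List using (List; []; _∷_)
open import Data.List.Membership.Propositional using (_∈_)
open import Data.List.Membership.Propositional.Properties
  using (∈-concat⁺′; ∈-tabulate⁺; ∈-++⁺ˡ; ∈-++⁺ʳ)
open import Data.List.Relation.Unary.All as All using (All; []; _∷_)
import Data.List.Relation.Unary.All.Properties as All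
open import Data.List.Relation.Unary.Any as Any using (Any; here; there)
import Data.List.Relation.Unary.Any.Properties as Any
open import Data.Maybe.Base using (Maybe; just; nothing)
open import Data.Nat.Base using (ℕ; suc; _+_)
open import Data.Product using (Σ-syntax; ∃; ∃₂; ∃-syntax; ∃!; _×_; _,_; proj₁; proj₂; uncurry)
open import Data.Sum.Base as Sum using (_⊎_; inj₁; inj₂; [_,_]′)
open import Data.Vec.Base as Vec using (Vec; []; _∷_; lookup; tabulate; _++_)
import Data.Vec.Properties as Vec
open import Function.Base using (_∘_; id; case_of_)
open import Function.Bundles using (Equivalence; Func; _⇔_; mk⇔)
open import Level using (Level; _⊔_; Lift; lift) renaming (suc to lsuc)
open import Relation.Binary.Bundles using (Setoid)
open import Relation.Binary.Definitions using (_Respects_)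
open import Relation.Binary.PropositionalEquality using (_≡_; refl; sym; trans; cong; cong₂; subst)
import Relation.Binary.Reasoning.Setoid as SetoidReasoning
open import Relation.Nullary.Decidable using (Dec; yes; no; does; decidable-stable)
open import Relation.Nullary.Negation using (¬_; contradiction)
open import Relation.Unary using (Pred; _⊆_; _⊥_; _≐_; ∁; _∩_)

open Equivalence using (to; from)

private variable
  a : Level

-- Classical logic and the Teichmüller-Tukey lemma.

module Classical (lem : ∀ {a} → ExcludedMiddle a) where

  -- A truth value lies in the smallest universe whatever the level of the proposition, which is
  -- what the Boolean-valued complete types require.
  ⌜_⌝ : Set a → Bool
  ⌜ P ⌝ = does (lem {P = P})

  ⌜⌝⁺ : {P : Set a} → P → T ⌜ P ⌝
  ⌜⌝⁺ {P = P} x with lem {P = P}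
  ... | yes _ = _
  ... | no ¬x = contradiction x ¬x

  ⌜⌝⁻ : {P : Set a} → T ⌜ P ⌝ → P
  ⌜⌝⁻ {P = P} t with lem {P = P}
  ... | yes x = x

  byContradiction : {P : Set a} → ¬ ¬ P → P
  byContradiction = decidable-stable lem

-- The tower generated by adding one admissible element and by taking unions is linearly
-- ordered, so its own union is consistent; being in the tower, it cannot be extended.
module TeichmüllerTukey (lem : ∀ {a} → ExcludedMiddle a) (ext : ∀ {a b} → Extensionality a b)
                        {a g} {A : Set a} (Good : List A → Set g) where
  open Classical lem

  -- With Boolean values instead of propositions, families of subsets are again of level `a`, so
  -- `Tower` can quantify over them without leaving `Set a`.
  Subset : Set a
  Subset = A → Bool

  Consistent : Subset → Set _
  Consistent X = ∀ as → All (T ∘ X) as → Good as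

  infix 4 _⊑_
  _⊑_ : Subset → Subset → Set a
  X ⊑ Y = ∀ x → T (X x) → T (Y x)

  insert : A → Subset → Subset
  insert x X y = X y ∨ ⌜ y ≡ x ⌝

  Extensible : Subset → Set _
  Extensible X = ∃[ x ] ¬ T (X x) × Consistent (insert x X)

  -- The decision is an argument, so that proofs about `step` can match on it directly.
  extend : ∀ X → Dec (Extensible X) → Subset
  extend X (yes (x , _)) = insert x X
  extend X (no  _)       = X

  step : Subset → Subset
  step X = extend X lem

  union : (Subset → Bool) → Subset
  union P x = ⌜ ∃[ X ] T (P X) × T (X x) ⌝

  -- `join` of the empty family supplies the least member, the empty subset.
  data Tower : Subset → Set a where
    next : ∀ {X} → Tower X → Tower (step X)
    join : ∀ P → (∀ {X} → T (P X) → Tower X) → Tower (union P)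

  ⊑-trans : ∀ {X Y Z} → X ⊑ Y → Y ⊑ Z → X ⊑ Z
  ⊑-trans f g x = g x ∘ f x

  ⊑-antisym : ∀ {X Y} → X ⊑ Y → Y ⊑ X → X ≡ Y
  ⊑-antisym {X} {Y} f g = ext λ x → same (f x) (g x)
    where
    same : ∀ {b c} → (T b → T c) → (T c → T b) → b ≡ c
    same {false} {false} _ _ = refl
    same {false} {true}  _ k with () ← k _
    same {true}  {false} h _ with () ← h _
    same {true}  {true}  _ _ = refl

  ⊑-step : ∀ {X} → X ⊑ step X
  ⊑-step {X} = ⊑-extend lem
    where
    ⊑-extend : ∀ d → X ⊑ extend X d
    ⊑-extend (yes _) x = from T-∨ ∘ inj₁
    ⊑-extend (no _)  x = id

  -- A step adds at most one element, so a set in between is decided by whether it contains that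
  -- element.
  ⊑-step-cases : ∀ {X Y} → X ⊑ Y → Y ⊑ step X → step X ⊑ Y ⊎ Y ≡ X
  ⊑-step-cases {X} {Y} X⊑Y = cases lem
    where
    cases : ∀ d → Y ⊑ extend X d → extend X d ⊑ Y ⊎ Y ≡ X
    cases (no _) Y⊑X = inj₁ X⊑Y
    cases (yes (x , _)) Y⊑X+x with T? (Y x)
    ... | yes x∈Y = inj₁ λ y → [ X⊑Y y , (λ t → subst (T ∘ Y) (sym (⌜⌝⁻ t)) x∈Y) ]′ ∘ to T-∨
    ... | no  x∉Y = inj₂ (⊑-antisym
      (λ y y∈Y → [ id , (λ t → contradiction (subst (T ∘ Y) (⌜⌝⁻ t) y∈Y) x∉Y) ]′ (to T-∨ (Y⊑X+x y y∈Y)))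
      X⊑Y)

  module _ {X} (compare : ∀ {Y} → Tower Y → X ⊑ Y ⊎ step Y ⊑ X) where

    mutual
      -- The critical case has Y between X and `step X`: then Y either contains `step X` or equals
      -- X, and in the latter case the two steps coincide.
      step-compare : ∀ {Y} → Tower Y → step X ⊑ Y ⊎ step Y ⊑ step X
      step-compare tY with compare tY
      ... | inj₂ sY⊑X = inj₂ (⊑-trans sY⊑X ⊑-step)
      ... | inj₁ X⊑Y with step-linear tY
      ...   | inj₁ sX⊑Y = inj₁ sX⊑Y
      ...   | inj₂ Y⊑sX = Sum.map₂ (λ { refl _ → id }) (⊑-step-cases X⊑Y Y⊑sX)

      step-linear : ∀ {Y} → Tower Y → step X ⊑ Y ⊎ Y ⊑ step X
      step-linear (next tY) = Sum.map₁ (λ sX⊑Y → ⊑-trans sX⊑Y ⊑-step) (step-compare tY)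
      step-linear (join Q Q⊆T) with lem {P = ∃[ Z ] T (Q Z) × step X ⊑ Z}
      ... | yes (Z , QZ , sX⊑Z) = inj₁ λ x x∈ → ⌜⌝⁺ (Z , QZ , sX⊑Z x x∈)
      ... | no  none = inj₂ λ x x∈ → let (Z , QZ , x∈Z) = ⌜⌝⁻ x∈ in
        [ (λ sX⊑Z → contradiction (Z , QZ , sX⊑Z) none)
        , (λ sZ⊑sX → sZ⊑sX x (⊑-step x x∈Z)) ]′ (step-compare (Q⊆T QZ))

  -- Induction on the construction of X. The step on the right makes the hypothesis strong enough
  -- for the successor case; an inclusion of Y in X would not bound `step Y`.
  compare : ∀ {X Y} → Tower X → Tower Y → X ⊑ Y ⊎ step Y ⊑ X
  compare (next tX)    tY = step-compare (compare tX) tY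
  compare {Y = Y} (join P P⊆T) tY with lem {P = ∃[ Z ] T (P Z) × step Y ⊑ Z}
  ... | yes (Z , PZ , sY⊑Z) = inj₂ λ x x∈ → ⌜⌝⁺ (Z , PZ , sY⊑Z x x∈)
  ... | no  none = inj₁ λ x x∈ → let (Z , PZ , x∈Z) = ⌜⌝⁻ x∈ in
    [ (λ Z⊑Y → Z⊑Y x x∈Z) , (λ sY⊑Z → contradiction (Z , PZ , sY⊑Z) none) ]′ (compare (P⊆T PZ) tY)

  linear : ∀ {X Y} → Tower X → Tower Y → X ⊑ Y ⊎ Y ⊑ X
  linear tX tY = Sum.map₂ (⊑-trans ⊑-step) (compare tX tY)

  -- By linearity, the largest of the members that contain the individual elements contains them
  -- all. The list is nonempty because the family P may be empty.
  union-finite : ∀ {P} → (∀ {X} → T (P X) → Tower X) →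
                 ∀ a as → All (T ∘ union P) (a ∷ as) → ∃[ X ] T (P X) × All (T ∘ X) (a ∷ as)
  union-finite P⊆T a [] (a∈ ∷ []) = let (X , PX , a∈X) = ⌜⌝⁻ a∈ in X , PX , a∈X ∷ []
  union-finite P⊆T a (b ∷ as) (a∈ ∷ as∈) with ⌜⌝⁻ a∈ | union-finite P⊆T b as as∈
  ... | X , PX , a∈X | Y , PY , as∈Y with linear (P⊆T PX) (P⊆T PY)
  ...   | inj₁ X⊑Y = Y , PY , X⊑Y a a∈X ∷ as∈Y
  ...   | inj₂ Y⊑X = X , PX , a∈X ∷ All.map (Y⊑X _) as∈Y

  tower-consistent : Good [] → ∀ {X} → Tower X → Consistent X
  tower-consistent good[] (next {X} tX) = extend-consistent lem
    where
    extend-consistent : ∀ d → Consistent (extend X d)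
    extend-consistent (yes (_ , _ , c)) = c
    extend-consistent (no _)            = tower-consistent good[] tX
  tower-consistent good[] (join P P⊆T) []       _  = good[]
  tower-consistent good[] (join P P⊆T) (a ∷ as) as∈ =
    let (X , PX , as∈X) = union-finite P⊆T a as as∈ in tower-consistent good[] (P⊆T PX) (a ∷ as) as∈X

  maximal : Good [] → ∃[ X ] Consistent X × (∀ x → Consistent (insert x X) → T (X x))
  maximal good[] = X , tower-consistent good[] tX , λ x c → byContradiction λ x∉X →
    ¬extensible lem (λ y y∈ → ⌜⌝⁺ (step X , ⌜⌝⁺ (next tX) , y∈)) (x , x∉X , c)
    where
    P : Subset → Bool
    P X = ⌜ Tower X ⌝

    X = union P
    tX : Tower X
    tX = join P ⌜⌝⁻

    ¬extensible : ∀ d → extend X d ⊑ X → ¬ Extensible X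
    ¬extensible (no ¬e)             _   = ¬e
    ¬extensible (yes (x , x∉X , _)) s⊑X = λ _ → x∉X (s⊑X x (from T-∨ (inj₂ (⌜⌝⁺ refl))))

-- Open sets given locally, and regularity of compact spaces.

module TopologyProperties {ℓ o} {X : Setoid ℓ ℓ} (TX : Topology X o) where
  open Setoid X using (Carrier; _≈_) renaming (refl to ≈-refl)
  open Topology TX

  -- The union is indexed by the points of V, which form a type of level `ℓ`; the open subsets of V
  -- would be too large an index.
  open-local : ∀ {V : Pred Carrier ℓ} →
               (∀ x → V x → Σ[ N ∈ Pred Carrier ℓ ] IsOpen N × N x × N ⊆ V) → IsOpen V
  open-local loc = open-resp-≐
    ((λ ((x , v) , n) → proj₂ (proj₂ (proj₂ (loc x v))) n)
    , λ {x} v → (x , v) , proj₁ (proj₂ (proj₂ (loc x v))))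
    (open-⋃ λ (x , v) → proj₁ (proj₂ (loc x v)))

  open-∅ : IsOpen (λ _ → ⊥ₚ.⊥)
  open-∅ = open-resp-≐ ((λ ()) , λ ()) (open-⋃ {I = ⊥ₚ.⊥} {V = λ _ x → x ≈ x} λ ())

  open-∪ : ∀ {V W} → IsOpen V → IsOpen W → IsOpen (λ x → V x ⊎ W x)
  open-∪ {V} {W} oV oW = open-local λ where
    x (inj₁ v) → V , oV , v , inj₁
    x (inj₂ w) → W , oW , w , inj₂

  module _ (lem : ∀ {a} → ExcludedMiddle a) (compact : IsCompact) where
    open Classical lem
    open IsCompact compact

    -- Points of V are covered by V itself, all others by a neighbourhood disjoint from one of c.
    -- From a finite subcover, N is the intersection of the neighbourhoods of c and W the union of
    -- the opposite ones. Covering the space by V and W replaces saying that the closure of N lies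
    -- in V.
    regular : ∀ {V c} → IsOpen V → V c → Σ[ N ∈ Pred Carrier ℓ ] Σ[ W ∈ Pred Carrier ℓ ]
              IsOpen N × N c × IsOpen W × N ⊥ W × (∀ x → V x ⊎ W x)
    regular {V} {c} oV Vc = let (N , W , oN , Nc , oW , N⊥W , V∪W) = combine ys in
      N , W , oN , Nc , oW , N⊥W , λ x → V∪W x (covers x)
      where
      Separation : Carrier → Pred Carrier ℓ → Set _
      Separation y B = Σ[ A ∈ Pred Carrier ℓ ] IsOpen A × A c × IsOpen B × B y × (A ⊥ B ⊎ B ⊆ V)

      separate : ∀ y → ∃ (Separation y)
      separate y with lem {P = V y}
      ... | yes Vy = V , _ , open-U , ≈-refl , oV , Vy , inj₂ id
      ... | no ¬Vy =
        let (A , B , oA , Ac , oB , By , A⊥B) =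
              hausdorff c y (λ c≈y → ¬Vy (open-resp-≈ oV c≈y Vc))
        in B , A , oA , Ac , oB , By , inj₁ A⊥B

      B : Carrier → Pred Carrier ℓ
      B y = proj₁ (separate y)

      cover = finiteSubcover B
        (λ y → let (_ , _ , _ , _ , oB , _) = separate y in oB)
        (λ y → y , (let (_ , _ , _ , _ , _ , By , _) = separate y in By))
      ys     = proj₁ cover
      covers = proj₂ cover

      combine : ∀ ys → Σ[ N ∈ Pred Carrier ℓ ] Σ[ W ∈ Pred Carrier ℓ ]
        IsOpen N × N c × IsOpen W × N ⊥ W × (∀ x → Any (λ y → B y x) ys → V x ⊎ W x)
      combine [] = _ , _ , open-U , ≈-refl , open-∅ , (λ ()) , λ _ ()
      combine (y ∷ ys) with combine ys | proj₂ (separate y)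
      ... | N , W , oN , Nc , oW , N⊥W , c′ | A , oA , Ac , oB , _ , inj₁ A⊥B =
        A ∩ N , (λ x → B y x ⊎ W x) , open-∩ oA oN , (Ac , Nc) , open-∪ oB oW ,
        (λ { ((a , n) , inj₁ b) → A⊥B (a , b) ; ((a , n) , inj₂ w) → N⊥W (n , w) }) ,
        λ { x (here b)  → inj₂ (inj₁ b)
          ; x (there t) → Sum.map₂ inj₂ (c′ x t) }
      ... | N , W , oN , Nc , oW , N⊥W , c′ | A , oA , Ac , oB , _ , inj₂ B⊆V =
        N , W , oN , Nc , oW , N⊥W , λ { x (here b) → inj₁ (B⊆V b) ; x (there t) → c′ x t }

-- Complete types: extension of partial types and compactness.

module Types {ℓ} {L : Language ℓ} (𝓜 : Structure L) where
  open FirstOrder 𝓜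
  open CompleteType

  module _ {n} {δ : Formulaᴹ n} (p : CompleteType δ) where

    realise : ∀ {φ} → p ∋ φ → ∃[ a ] proj₁ {B = _⊨ δ} a ⊨ φ
    realise {φ} pφ with finsat p (δ ∷ φ ∷ []) (mem-δ p ∷ pφ ∷ [])
    ... | v , d ∷ s ∷ [] = (v , d) , s

    ∋⊎∋¬ : ∀ φ → p ∋ φ ⊎ p ∋ (¬′ φ)
    ∋⊎∋¬ φ with mem p φ in e
    ... | true  = inj₁ _
    ... | false = inj₂ (∌⇒∋¬ p φ e)

    ∋¬⇒∌ : ∀ {φ} → p ∋ (¬′ φ) → ¬ p ∋ φ
    ∋¬⇒∌ {φ} p¬φ pφ with finsat p (φ ∷ ¬′ φ ∷ []) (pφ ∷ p¬φ ∷ [])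
    ... | _ , s ∷ t ∷ [] = t s

    ∋-mono : ∀ {φ ψ} → (∀ (a : Setoid.Carrier (Points δ)) → proj₁ a ⊨ φ → proj₁ a ⊨ ψ) →
             p ∋ φ → p ∋ ψ
    ∋-mono {φ} {ψ} φ⇒ψ pφ with ∋⊎∋¬ ψ
    ... | inj₁ pψ  = pψ
    ... | inj₂ p¬ψ = let (a , s , t) = realise (∋-∧ p pφ p¬ψ) in contradiction (φ⇒ψ a s) t

  module _ (lem : ∀ {a} → ExcludedMiddle a) (ext : ∀ {a b} → Extensionality a b)
           {n} {δ : Formulaᴹ n} where
    open Classical lem

    FinitelySatisfiable : ∀ {b} → Pred (Formulaᴹ n) b → Set _
    FinitelySatisfiable Γ = ∀ γs → All Γ γs → ∃[ v ] All (v ⊨_) γs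

    -- Maximality is applied to the lists that are satisfiable together with every finite part of Γ.
    -- Building Γ into the consistency condition forces a maximal set to contain it.
    lindenbaum : ∀ {b} (Γ : Pred (Formulaᴹ n) b) → FinitelySatisfiable Γ → Γ δ →
                 Σ[ p ∈ CompleteType δ ] ∀ {φ} → Γ φ → p ∋ φ
    lindenbaum Γ satΓ δ∈Γ = record
      { mem      = X
      ; complete = X-complete
      ; finsat   = X-finsat
      ; mem-δ    = Γ⊆X δ∈Γ
      } , Γ⊆X
      where
      Good : List (Formulaᴹ n) → Set _
      Good φs = ∀ γs → All Γ γs → ∃[ v ] All (v ⊨_) (φs List.++ γs)

      module TT = TeichmüllerTukey lem ext Good

      maximal = TT.maximal satΓ
      X     = proj₁ maximal
      X-con = proj₁ (proj₂ maximal)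
      X-max = proj₂ (proj₂ maximal)

      X-finsat : ∀ φs → All (T ∘ X) φs → ∃[ v ] All (v ⊨_) φs
      X-finsat φs φs∈X = let (v , s) = X-con φs φs∈X [] [] in v , All.++⁻ˡ φs s

      -- Reduces consistency of X with φ added to satisfying φ along with lists from X alone.
      without : ∀ φ {φs} → All (T ∘ TT.insert φ X) φs →
                ∃[ ψs ] All (T ∘ X) ψs × (∀ v → v ⊨ φ → All (v ⊨_) ψs → All (v ⊨_) φs)
      without φ [] = [] , [] , λ _ _ _ → []
      without φ (_∷_ {ψ} t ts) with without φ ts | to (T-∨ {X ψ}) t
      ... | ψs , ψs∈X , i | inj₁ ψ∈X = ψ ∷ ψs , ψ∈X ∷ ψs∈X , λ { v s (u ∷ us) → u ∷ i v s us }
      ... | ψs , ψs∈X , i | inj₂ eq with refl ← ⌜⌝⁻ eq = ψs , ψs∈X , λ v s us → s ∷ i v s us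

      X-max′ : ∀ φ → (∀ ψs → All (T ∘ X) ψs → ∀ γs → All Γ γs →
                 ∃[ v ] v ⊨ φ × All (v ⊨_) ψs × All (v ⊨_) γs) → T (X φ)
      X-max′ φ h = X-max φ λ as as∈ γs γs∈ →
        let (ψs , ψs∈X , i)    = without φ as∈
            (v , s , us , ss) = h ψs ψs∈X γs γs∈
        in v , All.++⁺ (i v s us) ss

      X-models : ∀ ψs → All (T ∘ X) ψs → ∀ γs → All Γ γs → ∃[ v ] All (v ⊨_) ψs × All (v ⊨_) γs
      X-models ψs ψs∈X γs γs∈Γ =
        let (v , s) = X-con ψs ψs∈X γs γs∈Γ in v , All.++⁻ˡ ψs s , All.++⁻ʳ ψs s

      Γ⊆X : ∀ {φ} → Γ φ → T (X φ)
      Γ⊆X {φ} φ∈Γ = X-max′ φ λ ψs ψs∈X γs γs∈Γ →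
        case X-models ψs ψs∈X (φ ∷ γs) (φ∈Γ ∷ γs∈Γ) of λ { (v , us , s ∷ ss) → v , s , us , ss }

      -- If some finite part of X and Γ had no model of `¬′ φ`, then φ would hold in all its models,
      -- and so could be added to X.
      ∌⇒∋¬′ : ∀ φ → ¬ T (X φ) → T (X (¬′ φ))
      ∌⇒∋¬′ φ φ∉X = X-max′ (¬′ φ) λ ψs ψs∈X γs γs∈Γ → byContradiction λ none →
        φ∉X (X-max′ φ λ ψs′ ψs′∈X γs′ γs′∈Γ →
          let (v , us , ss) = X-models (ψs List.++ ψs′) (All.++⁺ ψs∈X ψs′∈X)
                                       (γs List.++ γs′) (All.++⁺ γs∈Γ γs′∈Γ)
          in v , byContradiction (λ ¬s → none (v , ¬s , All.++⁻ˡ ψs us , All.++⁻ˡ γs ss))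
               , All.++⁻ʳ ψs us , All.++⁻ʳ γs ss)

      X-complete : ∀ φ → X (¬′ φ) ≡ not (X φ)
      X-complete φ with X φ in e | X (¬′ φ) in e′
      ... | true  | false = refl
      ... | false | true  = refl
      ... | true  | true  =
        case X-finsat (φ ∷ ¬′ φ ∷ []) (from T-≡ e ∷ from T-≡ e′ ∷ []) of
          λ { (v , s ∷ t ∷ []) → contradiction s t }
      ... | false | false = trans (sym e′) (to T-≡ (∌⇒∋¬′ φ (subst T e)))

    -- Without a finite subcover, Γ is finitely satisfiable and extends to a type p. Some `V i`
    -- contains a basic neighbourhood φ of p; but then `¬′ φ` belongs to Γ and hence to p.
    type-finiteSubcover : ∀ {I : Set ℓ} (V : I → Pred (CompleteType δ) ℓ) →
                          (∀ i → Topology.IsOpen (logicTopology δ) (V i)) → (∀ p → ∃[ i ] V i p) →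
                          Σ[ is ∈ List I ] (∀ p → Any (λ i → V i p) is)
    type-finiteSubcover {I} V V-open V-cover = byContradiction λ none →
      let (p , Γ⊆p)     = lindenbaum Γ (sat none) δ∈Γ
          (i , Vip)     = V-cover p
          (φ , pφ , φ⊆V) = V-open i p Vip
      in ∋¬⇒∌ p (Γ⊆p {¬′ φ} (i ∷ [] , λ q q¬¬φ → here (φ⊆V {q} (∋-mono q (λ _ → byContradiction) q¬¬φ)))) pφ
      where
      -- The complements of the clopen sets covered by finitely many V i.
      Γ : Pred (Formulaᴹ n) ℓ
      Γ φ = Σ[ is ∈ List I ] ∀ q → q ∋ (¬′ φ) → Any (λ i → V i q) is

      δ∈Γ : Γ δ
      δ∈Γ = [] , λ q q¬δ → contradiction (mem-δ q) (∋¬⇒∌ q q¬δ)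

      covered : ∀ φs → All Γ φs →
                Σ[ is ∈ List I ] ∀ q → Any (λ φ → q ∋ (¬′ φ)) φs → Any (λ i → V i q) is
      covered [] [] = [] , λ _ ()
      covered (φ ∷ φs) ((is , c) ∷ γs) = let (js , d) = covered φs γs in
        is List.++ js , λ { q (here t) → Any.++⁺ˡ (c q t) ; q (there t) → Any.++⁺ʳ is (d q t) }

      all⊎any : ∀ (q : CompleteType δ) φs → All (q ∋_) φs ⊎ Any (λ φ → q ∋ (¬′ φ)) φs
      all⊎any q [] = inj₁ []
      all⊎any q (φ ∷ φs) with ∋⊎∋¬ q φ | all⊎any q φs
      ... | inj₂ t | _      = inj₂ (here t)
      ... | inj₁ _ | inj₂ t = inj₂ (there t)
      ... | inj₁ s | inj₁ t = inj₁ (s ∷ t)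

      -- If the φs have no common model, every type contains the negation of one of them, and the
      -- finitely many indices attached to the φs cover everything.
      sat : ¬ (Σ[ is ∈ List I ] (∀ p → Any (λ i → V i p) is)) → FinitelySatisfiable Γ
      sat none φs φs∈Γ = byContradiction λ unsat → none
        (let (is , c) = covered φs φs∈Γ in is , λ p →
          [ (λ s → contradiction (finsat p φs s) unsat) , c p ]′ (all⊎any p φs))

-- Sections of jointly continuous maps.

module _ {ℓ o₁ o₂ o₃} {X Y Z : Setoid ℓ ℓ} {TX : Topology X o₁} {TY : Topology Y o₂} {TZ : Topology Z o₃}
         {f : Setoid.Carrier X → Setoid.Carrier Y → Setoid.Carrier Z}
         (f-cont : Continuous (productTopology TX TY) TZ (uncurry f)) where

  continuous-sectionʳ : ∀ x → Continuous TY TZ (f x)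
  continuous-sectionʳ x V oV = TopologyProperties.open-local TY λ y v →
    let (_ , N , _ , n₁ , oN , n , sub) = f-cont V oV x y v in N , oN , n , sub n₁

  continuous-sectionˡ : ∀ y → Continuous TX TZ (λ x → f x y)
  continuous-sectionˡ y V oV = TopologyProperties.open-local TX λ x v →
    let (N , _ , oN , n , _ , n₂ , sub) = f-cont V oV x y v in N , oN , n , λ n′ → sub n′ n₂

-- Substitution of blocks of variables.

module Blocks {ℓ} {L : Language ℓ} (𝓜 : Structure L) where
  open Structure 𝓜 renaming (Universe to M)
  open FirstOrder 𝓜

  block : ∀ {m n} → (Fin n → Fin m) → Vec (Term L M m) n
  block ρ = tabulate (var ∘ ρ)

  eval-block : ∀ {m n} {w : Vec M m} {u : Vec M n} (ρ : Fin n → Fin m) →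
               (∀ i → lookup w (ρ i) ≡ lookup u i) → Vec.map (eval w) (block ρ) ≡ u
  eval-block {w = w} {u} ρ e = trans (sym (Vec.tabulate-∘ (eval w) (var ∘ ρ)))
    (trans (Vec.tabulate-cong e) (Vec.tabulate∘lookup u))

  ⊨-substitute : ∀ {m n} {w : Vec M m} {u : Vec M n} {σ : Vec (Term L M m) n} →
                 Vec.map (eval w) σ ≡ u → ∀ φ → (w ⊨ substᶠ id σ φ) ⇔ (u ⊨ φ)
  ⊨-substitute {w = w} {σ = σ} refl φ = ⊨-subst w σ φ

  eval-vars : ∀ {n} (v : Vec M n) → Vec.map (eval v) (vars n) ≡ v
  eval-vars v = eval-block id λ _ → refl

  eval-params : ∀ {m n} (v : Vec M m) (a : Vec M n) → Vec.map (eval v) (Vec.map par a) ≡ a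
  eval-params v a = trans (sym (Vec.map-∘ _ _ a)) (Vec.map-id a)

  module _ {m n k : ℕ} where

    first : Vec (Term L M (m + (n + k))) m
    first = block (λ i → i ↑ˡ (n + k))

    second : Vec (Term L M (m + (n + k))) n
    second = block (λ i → m ↑ʳ (i ↑ˡ k))

    third : Vec (Term L M (m + (n + k))) k
    third = block (λ i → m ↑ʳ (n ↑ʳ i))

    module _ (u : Vec M m) (v : Vec M n) (w : Vec M k) where

      eval-first : Vec.map (eval (u ++ (v ++ w))) first ≡ u
      eval-first = eval-block (_↑ˡ (n + k)) (Vec.lookup-++ˡ u (v ++ w))

      eval-second : Vec.map (eval (u ++ (v ++ w))) second ≡ v
      eval-second = eval-block (λ i → m ↑ʳ (i ↑ˡ k)) λ i →
        trans (Vec.lookup-++ʳ u (v ++ w) (i ↑ˡ k)) (Vec.lookup-++ˡ v w i)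

      eval-third : Vec.map (eval (u ++ (v ++ w))) third ≡ w
      eval-third = eval-block (λ i → m ↑ʳ (n ↑ʳ i)) λ i →
        trans (Vec.lookup-++ʳ u (v ++ w) (n ↑ʳ i)) (Vec.lookup-++ʳ v w i)

-- Neighbourhoods of the identity and the relation `∼μ`.

module Infinitesimals {ℓ} {L : Language ℓ} {𝓜 : Structure L} (G : DefinableTopologicalGroup 𝓜) where
  open Structure 𝓜 renaming (Universe to M)
  open FirstOrder 𝓜
  open DefinableTopologicalGroup G
  open μTypes G
  open CompleteType using (mem-δ)
  open Types 𝓜
  open Blocks 𝓜
  open Topology topology using (open-resp-≐; open-∩)
  module 𝔾 = Group group
  module 𝔾ₚ = GroupProperties group

  infix 4 _⊩_
  -- A record, because `_⊨_` computes by recursion on the formula and would hide both g and φ from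
  -- unification.
  record _⊩_ (g : Carrier) (φ : Formulaᴹ dim) : Set ℓ where
    constructor sat
    field holds : proj₁ g ⊨ φ

  open _⊩_ public

  ⊩-resp : ∀ {φ g h} → g ≈ h → g ⊩ φ → h ⊩ φ
  ⊩-resp {φ} g≈h (sat s) = sat (subst (_⊨ φ) g≈h s)

  ⊩-∧ : ∀ {g φ ψ} → g ⊩ φ → g ⊩ ψ → g ⊩ (φ ∧′ ψ)
  ⊩-∧ (sat s) (sat t) = sat (s , t)

  ⊩-∧ˡ : ∀ {g φ ψ} → g ⊩ (φ ∧′ ψ) → g ⊩ φ
  ⊩-∧ˡ (sat (s , _)) = sat s

  ⊩-∧ʳ : ∀ {g φ ψ} → g ⊩ (φ ∧′ ψ) → g ⊩ ψ
  ⊩-∧ʳ (sat (_ , t)) = sat t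

  realise∧ : ∀ (p : CompleteType γ) {φ ψ} → p ∋ φ → p ∋ ψ → ∃[ g ] g ⊩ φ × g ⊩ ψ
  realise∧ p pφ pψ = let (g , s , t) = realise p (∋-∧ p pφ pψ) in g , sat s , sat t

  ∋-upward : ∀ (p : CompleteType γ) {φ ψ} → (∀ {g} → g ⊩ φ → g ⊩ ψ) → p ∋ φ → p ∋ ψ
  ∋-upward p φ⇒ψ = ∋-mono p λ g s → holds (φ⇒ψ {g} (sat s))

  block₁ block₂ block₃ : Vec (Term L M (dim + (dim + dim))) dim
  block₁ = first {dim} {dim} {dim}
  block₂ = second {dim} {dim} {dim}
  block₃ = third {dim} {dim} {dim}

  opaque
    -- The bound blocks are the two factors and the free block their product. The conjuncts `γ` keep
    -- all three in G, the only place where `mulᶠ` is specified.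
    prod : Formulaᴹ dim → Formulaᴹ dim → Formulaᴹ dim
    prod φ ψ = ∃ⁿ dim (∃ⁿ dim (mulᶠ ∧′ substᶠ id block₁ (γ ∧′ φ) ∧′
      substᶠ id block₂ (γ ∧′ ψ) ∧′ substᶠ id block₃ γ))

    prod-defines : ∀ φ ψ → DefinesProduct φ ψ (prod φ ψ)
    prod-defines φ ψ v = mk⇔ factor multiply
      where
      factor : v ⊨ prod φ ψ → ∃₂ λ a b → proj₁ a ⊨ φ × proj₁ b ⊨ ψ × v ≡ proj₁ (a ∙ b)
      factor s =
        let (b , s₁) = to (⊨-∃ⁿ dim v _) s
            (a , s₂ , s₃ , s₄ , s₅) = to (⊨-∃ⁿ dim (b ++ v) _) s₁
            (γa , φa) = to (⊨-substitute (eval-first a b v) (γ ∧′ φ)) s₃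
            (γb , ψb) = to (⊨-substitute (eval-second a b v) (γ ∧′ ψ)) s₄
            γv        = to (⊨-substitute (eval-third a b v) γ) s₅
        in (a , γa) , (b , γb) , φa , ψb , sym (to (mulᶠ-defines-∙ (a , γa) (b , γb) (v , γv)) s₂)

      multiply : (∃₂ λ a b → proj₁ a ⊨ φ × proj₁ b ⊨ ψ × v ≡ proj₁ (a ∙ b)) → v ⊨ prod φ ψ
      multiply (a , b , φa , ψb , refl) = let c = a ∙ b in
        from (⊨-∃ⁿ dim (proj₁ c) _) (proj₁ b , from (⊨-∃ⁿ dim (proj₁ b ++ proj₁ c) _) (proj₁ a ,
          from (mulᶠ-defines-∙ a b c) refl ,
          from (⊨-substitute (eval-first (proj₁ a) (proj₁ b) (proj₁ c)) (γ ∧′ φ)) (proj₂ a , φa) ,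
          from (⊨-substitute (eval-second (proj₁ a) (proj₁ b) (proj₁ c)) (γ ∧′ ψ)) (proj₂ b , ψb) ,
          from (⊨-substitute (eval-third (proj₁ a) (proj₁ b) (proj₁ c)) γ) (proj₂ c)))

  ⊩-prod⁺ : ∀ {φ ψ a b} → a ⊩ φ → b ⊩ ψ → a ∙ b ⊩ prod φ ψ
  ⊩-prod⁺ {φ} {ψ} {a} {b} (sat s) (sat t) = sat (from (prod-defines φ ψ _) (a , b , s , t , refl))

  ⊩-prod⁻ : ∀ {φ ψ g} → g ⊩ prod φ ψ → ∃₂ λ a b → a ⊩ φ × b ⊩ ψ × g ≈ a ∙ b
  ⊩-prod⁻ {φ} {ψ} (sat r) = let (a , b , s , t , eq) = to (prod-defines φ ψ _) r in
    a , b , sat s , sat t , eq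

  ⊩-prod-mono : ∀ {φ φ′ ψ ψ′ g} → (∀ {a} → a ⊩ φ → a ⊩ φ′) → (∀ {b} → b ⊩ ψ → b ⊩ ψ′) →
                g ⊩ prod φ ψ → g ⊩ prod φ′ ψ′
  ⊩-prod-mono φ⊆φ′ ψ⊆ψ′ s = let (_ , _ , a⊩ , b⊩ , g≈ab) = ⊩-prod⁻ s in
    ⊩-resp (sym g≈ab) (⊩-prod⁺ (φ⊆φ′ a⊩) (ψ⊆ψ′ b⊩))

  -- Only the trace of U on G counts here; conjoining `γ` turns such a formula into a member of `μ`.
  record Nbhd (U : Formulaᴹ dim) : Set ℓ where
    constructor nbhd
    field
      isOpen : IsOpen (_⊩ U)
      ε⊩     : ε ⊩ U

  open Nbhd public

  leftTranslate-open : ∀ g {V} → IsOpen V → IsOpen (λ x → V (g ∙ x))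
  leftTranslate-open g oV =
    continuous-sectionʳ {TX = topology} {topology} {topology} {_∙_} ∙-continuous g _ oV

  rightTranslate-open : ∀ g {V} → IsOpen V → IsOpen (λ x → V (x ∙ g))
  rightTranslate-open g oV =
    continuous-sectionˡ {TX = topology} {topology} {topology} {_∙_} ∙-continuous g _ oV

  definableNbhd : ∀ {V : Pred Carrier ℓ} → IsOpen V → V ε → ∃[ U ] Nbhd U × (∀ {g} → g ⊩ U → V g)
  definableNbhd {V} oV Vε =
    let (W , (φ , eq) , oW , Wε , W⊆V) = definableBasis V oV Vε in
    φ , nbhd (open-resp-≐ ((λ {g} w → sat (from (eq g) w)) , λ {g} (sat s) → to (eq g) s) oW)
             (sat (from (eq ε) Wε)) ,
    λ {g} (sat s) → W⊆V (to (eq g) s)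

  nbhd-∧ : ∀ {U V} → Nbhd U → Nbhd V → Nbhd (U ∧′ V)
  nbhd-∧ (nbhd oU εU) (nbhd oV εV) = nbhd
    (open-resp-≐ ((λ (s , t) → ⊩-∧ s t) , λ (sat (s , t)) → sat s , sat t) (open-∩ oU oV))
    (⊩-∧ εU εV)

  nbhd-γ : Nbhd γ
  nbhd-γ = nbhd
    (open-resp-≐ ((λ {g} _ → sat (proj₂ g)) , λ _ → refl) (Topology.open-U topology))
    (sat (proj₂ ε))

  nbhd-square : ∀ {U} → Nbhd U → ∃[ V ] Nbhd V × (∀ {a b} → a ⊩ V → b ⊩ V → a ∙ b ⊩ U)
  nbhd-square {U} (nbhd oU εU) =
    let (V₁ , V₂ , o₁ , ε₁ , o₂ , ε₂ , sub) =
          ∙-continuous (_⊩ U) oU ε ε (⊩-resp (sym (𝔾.identityˡ ε)) εU)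
        (V , nV , V⊆) = definableNbhd (open-∩ o₁ o₂) (ε₁ , ε₂)
    in V , nV , λ a b → sub (proj₁ (V⊆ a)) (proj₂ (V⊆ b))

  nbhd-inverse : ∀ {U} → Nbhd U → ∃[ V ] Nbhd V × (∀ {a} → a ⊩ V → a ⁻¹ ⊩ U)
  nbhd-inverse {U} (nbhd oU εU) =
    definableNbhd (⁻¹-continuous (_⊩ U) oU) (⊩-resp (sym 𝔾ₚ.ε⁻¹≈ε) εU)

  nbhd-quotient : ∀ {U} → Nbhd U → ∃[ V ] Nbhd V × (∀ {a b} → a ⊩ V → b ⊩ V → (a ⁻¹) ∙ b ⊩ U)
  nbhd-quotient nU =
    let (V , nV , V²⊆U) = nbhd-square nU
        (W , nW , W⁻¹⊆V) = nbhd-inverse nV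
    in W ∧′ V , nbhd-∧ nW nV , λ (sat (a , _)) (sat (_ , b)) → V²⊆U (W⁻¹⊆V (sat a)) (sat b)

  -- Serves to move a small factor past g, by g(ux) = (gug⁻¹)(gx).
  nbhd-conjugate : ∀ g {U} → Nbhd U → ∃[ V ] Nbhd V × (∀ {a} → a ⊩ V → (g ∙ a) ∙ (g ⁻¹) ⊩ U)
  nbhd-conjugate g {U} (nbhd oU εU) = definableNbhd
    (leftTranslate-open g (rightTranslate-open (g ⁻¹) oU))
    (⊩-resp (sym (trans (𝔾.∙-congʳ {g ⁻¹} {g ∙ ε} {g} (𝔾.identityʳ g)) (𝔾.inverseʳ g))) εU)

  nbhd∈μ : ∀ {U} → Nbhd U → μ (U ∧′ γ)
  nbhd∈μ nU = let (nbhd o (sat ε∈)) = nbhd-∧ nU nbhd-γ in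
    (λ _ → proj₂) , open-resp-≐ (holds , sat) o , ε∈

  -- A derivation uses finitely many neighbourhoods, and their conjunction is again one.
  μ⊢-nbhd : ∀ {φ} → μ ⊢ φ → ∃[ U ] Nbhd U × (∀ {g} → g ⊩ U → g ⊩ φ)
  μ⊢-nbhd (derive ψs ψs⊆μ ψs⇒φ) =
    let (U , nU , U⊆) = conjunction ψs⊆μ in U , nU , λ s → sat (ψs⇒φ _ (U⊆ s))
    where
    conjunction : ∀ {ψs} → All μ ψs → ∃[ U ] Nbhd U × (∀ {g} → g ⊩ U → All (proj₁ g ⊨_) ψs)
    conjunction [] = γ , nbhd-γ , λ _ → []
    conjunction {ψ ∷ _} ((_ , oψ , εψ) ∷ ms) = let (U , nU , U⊆) = conjunction ms in
      ψ ∧′ U , nbhd-∧ (nbhd (open-resp-≐ (sat , holds) oψ) (sat εψ)) nU ,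
      λ {g} (sat (s , t)) → s ∷ U⊆ {g} (sat t)

  -- q ⊢ μ·p, stated without a formula for U·ψ and therefore visibly symmetric.
  record Near (p q : CompleteType γ) : Set ℓ where
    constructor near
    field
      meet : ∀ {U ψ θ} → Nbhd U → p ∋ ψ → q ∋ θ → ∃₂ λ u x → u ⊩ U × x ⊩ ψ × u ∙ x ⊩ θ

  open Near public

  -- If y = vx with v small, then x = v⁻¹y and v⁻¹ is small as well.
  near-sym : ∀ {p q} → Near p q → Near q p
  near-sym p≈q .meet nU qψ pθ =
    let (V , nV , V⁻¹⊆U)       = nbhd-inverse nU
        (v , x , v⊩ , x⊩ , vx⊩) = p≈q .meet nV pθ qψ
    in v ⁻¹ , v ∙ x , V⁻¹⊆U v⊩ , vx⊩ , ⊩-resp (sym (𝔾ₚ.\\-leftDividesʳ v x)) x⊩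

  -- Otherwise q contains the negation of U·ψ, and nearness yields a point of U·ψ satisfying that
  -- negation.
  near⇒∋prod : ∀ {p q U ψ} → Near p q → Nbhd U → p ∋ ψ → q ∋ prod U ψ
  near⇒∋prod {q = q} {U} {ψ} p≈q nU pψ with ∋⊎∋¬ q (prod U ψ)
  ... | inj₁ s = s
  ... | inj₂ t = let (u , x , u⊩ , x⊩ , ux) = p≈q .meet nU pψ t in
    contradiction (holds (⊩-prod⁺ u⊩ x⊩)) (holds ux)

  ∋-closed : ∀ {b} (p : CompleteType γ) {Γ : Pred (Formulaᴹ dim) b} {θ} → Γ ⊆ (p ∋_) → Γ ⊢ θ → p ∋ θ
  ∋-closed p {θ = θ} Γ⊆p (derive ψs ψs⊆Γ ψs⇒θ) with ∋⊎∋¬ p θ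
  ... | inj₁ pθ  = pθ
  ... | inj₂ p¬θ = inconsistent p (¬′ θ ∷ ψs) (p¬θ ∷ All.map Γ⊆p ψs⊆Γ)
    λ { (v , ¬s ∷ ss) → ¬s (ψs⇒θ v ss) }

  -- Since ε lies in every neighbourhood, the factorisation a = εa puts each realisation of ψ into
  -- U·ψ.
  μ·⊆ : ∀ p → (μ· p) ⊆ (p ∋_)
  μ·⊆ p {θ} (φ , ψ , _ , _ , μ⊢φ , p⊢ψ , θ-def) =
    let (_ , nU , U⊆φ) = μ⊢-nbhd μ⊢φ in
    ∋-mono p (λ a s → from (θ-def _) (ε , a , holds (U⊆φ (ε⊩ nU)) , s , sym (𝔾.identityˡ a)))
      (∋-closed p id p⊢ψ)

  prod∈μ· : ∀ p {U ψ} → Nbhd U → p ∋ ψ → (μ· p) (prod (U ∧′ γ) (ψ ∧′ γ))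
  prod∈μ· p {U} {ψ} nU pψ = U ∧′ γ , ψ ∧′ γ , (λ _ → proj₂) , (λ _ → proj₂) ,
    ⊢-axiom (nbhd∈μ nU) , ⊢-axiom (∋-∧ p pψ (mem-δ p)) , prod-defines (U ∧′ γ) (ψ ∧′ γ)

  -- U·ψ belongs to `μ· p`, so it follows from `μ· q` and lies in q; there it has a common
  -- realisation with θ.
  ∼⇒near : ∀ {p q} → p ∼μ q → Near p q
  ∼⇒near {p} {q} (mk∼μ (_ , p⇒q)) .meet nU pψ qθ =
    let q∋Uψ = ∋-closed q (μ·⊆ q) (p⇒q (prod∈μ· p nU pψ))
        (y , y⊩Uψ , y⊩θ) = realise∧ q q∋Uψ qθ
        (u , x , sat (u⊩ , _) , sat (x⊩ , _) , y≈ux) = ⊩-prod⁻ y⊩Uψ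
    in u , x , sat u⊩ , sat x⊩ , ⊩-resp y≈ux y⊩θ

  near⇒∼ : ∀ {p q} → Near p q → p ∼μ q
  near⇒∼ p≈q = mk∼μ (half p≈q , half (near-sym p≈q))
    where
    -- With V² inside U, nearness puts V·ψ into p. Then V·(V·ψ) is in `μ· p`, and it is contained in
    -- U·ψ and hence in θ.
    half : ∀ {p q θ} → Near p q → (μ· q) θ → μ· p ⊢ θ
    half {p} {q} {θ} p≈q (φ , ψ , _ , _ , μ⊢φ , q⊢ψ , θ-def) =
      let (U , nU , U⊆φ)  = μ⊢-nbhd μ⊢φ
          (V , nV , V²⊆U) = nbhd-square nU
          p∋Vψ            = near⇒∋prod (near-sym p≈q) nV (∋-closed q id q⊢ψ)
      in derive (prod (V ∧′ γ) (prod V ψ ∧′ γ) ∷ []) (prod∈μ· p nV p∋Vψ ∷ []) λ { v (s ∷ []) →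
        let (a , y , (a⊩ , _) , (y⊩ , _) , v≡ay) = to (prod-defines (V ∧′ γ) (prod V ψ ∧′ γ) v) s
            (b , x , b⊩ , x⊩ , y≈bx)             = ⊩-prod⁻ {g = y} (sat y⊩)
        in from (θ-def v) (a ∙ b , x , holds (U⊆φ (V²⊆U {a} (sat a⊩) b⊩)) , holds x⊩ ,
             trans v≡ay (trans (𝔾.∙-congˡ {a} {y} {b ∙ x} y≈bx) (sym (𝔾.assoc a b x)))) }

  ∋-mono⇒∼ : ∀ {p q : CompleteType γ} → (∀ {φ} → p ∋ φ → q ∋ φ) → p ∼μ q
  ∋-mono⇒∼ {p} {q} p⊆q = near⇒∼ (near λ nU pψ qθ →
    let (x , x⊩ψ , x⊩θ) = realise∧ q (p⊆q pψ) qθ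
    in ε , x , ε⊩ nU , x⊩ψ , ⊩-resp (sym (𝔾.identityˡ x)) x⊩θ)

-- Identities in groups.

module GroupIdentities {c ℓ} (𝔾 : Group c ℓ) where
  open Group 𝔾
  open GroupProperties 𝔾
  open SetoidReasoning setoid

  conjugate-∙ : ∀ g u x → ((g ∙ u) ∙ (g ⁻¹)) ∙ (g ∙ x) ≈ g ∙ (u ∙ x)
  conjugate-∙ g u x = begin
    ((g ∙ u) ∙ (g ⁻¹)) ∙ (g ∙ x) ≈⟨ assoc (g ∙ u) (g ⁻¹) (g ∙ x) ⟩
    (g ∙ u) ∙ ((g ⁻¹) ∙ (g ∙ x)) ≈⟨ ∙-congˡ (\\-leftDividesʳ g x) ⟩
    (g ∙ u) ∙ x                  ≈⟨ assoc g u x ⟩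
    g ∙ (u ∙ x)                  ∎

  -- Turns a factorisation of gx into one of hx; the first factor stays small when h is close to g.
  rebase : ∀ g h {x a b} → g ∙ x ≈ a ∙ b → h ∙ x ≈ ((h ∙ (g ⁻¹)) ∙ a) ∙ b
  rebase g h {x} {a} {b} gx≈ab = begin
    h ∙ x                        ≈⟨ ∙-congʳ (//-rightDividesˡ g h) ⟨
    ((h ∙ (g ⁻¹)) ∙ g) ∙ x       ≈⟨ assoc (h ∙ (g ⁻¹)) g x ⟩
    (h ∙ (g ⁻¹)) ∙ (g ∙ x)       ≈⟨ ∙-congˡ gx≈ab ⟩
    (h ∙ (g ⁻¹)) ∙ (a ∙ b)       ≈⟨ assoc (h ∙ (g ⁻¹)) a b ⟨
    ((h ∙ (g ⁻¹)) ∙ a) ∙ b       ∎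

  quotient-∙ : ∀ {a x b y} → a ∙ x ≈ b ∙ y → ((b ⁻¹) ∙ a) ∙ x ≈ y
  quotient-∙ {a} {x} {b} {y} ax≈by = begin
    ((b ⁻¹) ∙ a) ∙ x ≈⟨ assoc (b ⁻¹) a x ⟩
    (b ⁻¹) ∙ (a ∙ x) ≈⟨ ∙-congˡ ax≈by ⟩
    (b ⁻¹) ∙ (b ∙ y) ≈⟨ \\-leftDividesʳ b y ⟩
    y                ∎

-- Compactness of the space of μ-types, the embedding of G and the action.

module μSpace (lem : ∀ {a} → ExcludedMiddle a) (ext : ∀ {a b} → Extensionality a b)
              {ℓ} {L : Language ℓ} {𝓜 : Structure L} (G : DefinableTopologicalGroup 𝓜) where
  open FirstOrder 𝓜
  open DefinableTopologicalGroup G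
  open μTypes G
  open CompleteType using (mem-δ)
  open Classical lem
  open Types 𝓜
  open Blocks 𝓜
  open Infinitesimals G
  open GroupIdentities group
  open Topology topology using (open-resp-≈)
  open TopologyProperties topology using (open-local)
  module Sμ = Topology μTypeTopology

  -- x·ε = g.
  point : Carrier → Formulaᴹ dim
  point g = substᶠ id (vars dim ++ (Vec.map par (proj₁ ε) ++ Vec.map par (proj₁ g))) mulᶠ

  ⊩-point : ∀ {x} g → x ⊩ point g ⇔ x ≈ g
  ⊩-point {x} g = mk⇔
    (λ (sat s) → trans (sym (𝔾.identityʳ x)) (to (mulᶠ-defines-∙ x ε g) (to (⊨-substitute eq mulᶠ) s)))
    (λ x≈g → sat (from (⊨-substitute eq mulᶠ)
      (from (mulᶠ-defines-∙ x ε g) (trans (𝔾.identityʳ x) x≈g))))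
    where
    eq : Vec.map (eval (proj₁ x)) (vars dim ++ (Vec.map par (proj₁ ε) ++ Vec.map par (proj₁ g)))
         ≡ proj₁ x ++ (proj₁ ε ++ proj₁ g)
    eq = trans (Vec.map-++ _ (vars dim) _) (cong₂ _++_ (eval-vars (proj₁ x))
      (trans (Vec.map-++ _ (Vec.map par (proj₁ ε)) _)
        (cong₂ _++_ (eval-params (proj₁ x) (proj₁ ε)) (eval-params (proj₁ x) (proj₁ g)))))

  ⊩-translate⁻ : ∀ {g x φ} → x ⊩ translate g φ → g ∙ x ⊩ φ
  ⊩-translate⁻ {g} {x} {φ} (sat s) = sat (to (⊨-translate g x φ) s)

  ⊩-translate⁺ : ∀ {g x φ} → g ∙ x ⊩ φ → x ⊩ translate g φ
  ⊩-translate⁺ {g} {x} {φ} (sat s) = sat (from (⊨-translate g x φ) s)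

  χ-∋⁺ : ∀ {g φ} → g ⊩ φ → χ lem g ∋ φ
  χ-∋⁺ (sat s) = ⌜⌝⁺ s

  χ-∋⁻ : ∀ {g φ} → χ lem g ∋ φ → g ⊩ φ
  χ-∋⁻ t = sat (⌜⌝⁻ t)

  prod∋⇒near : ∀ {p q : CompleteType γ} →
               (∀ {U ψ} → Nbhd U → p ∋ ψ → q ∋ prod U ψ) → Near p q
  prod∋⇒near {p} {q} p⊆q = near λ nU pψ qθ →
    let (y , y⊩Uψ , y⊩θ)         = realise∧ q (p⊆q nU pψ) qθ
        (u , x , u⊩ , x⊩ , y≈ux) = ⊩-prod⁻ y⊩Uψ
    in u , x , u⊩ , x⊩ , ⊩-resp y≈ux y⊩θ

  -- μ · r ⊢ A.
  Inner : Pred Carrier ℓ → Pred (CompleteType γ) ℓ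
  Inner A r = ∃₂ λ U ψ → Nbhd U × r ∋ ψ × (∀ {u x} → u ⊩ U → x ⊩ ψ → A (u ∙ x))

  -- For invariance, shrink U to V with V² inside U: a type q equivalent to p contains V·ψ, and
  -- V·(V·ψ) stays inside A. For openness, the same U and ψ serve every type containing ψ.
  inner-open : ∀ {A} → A Respects _≈_ → Sμ.IsOpen (Inner A)
  inner-open {A} A-resp =
    (λ { {p} {q} p∼q (U , ψ , nU , pψ , Uψ⊆A) →
      let (V , nV , V²⊆U) = nbhd-square nU in
      V , prod V ψ , nV , near⇒∋prod (∼⇒near p∼q) nV pψ , λ {v} {y} v⊩ y⊩ →
        let (a , b , a⊩ , b⊩ , y≈ab) = ⊩-prod⁻ y⊩ in
        A-resp {(v ∙ a) ∙ b} {v ∙ y}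
          (trans (𝔾.assoc v a b) (𝔾.∙-congˡ {v} {a ∙ b} {y} (sym y≈ab)))
          (Uψ⊆A (V²⊆U v⊩ a⊩) b⊩) }) ,
    λ p (U , ψ , nU , pψ , Uψ⊆A) → ψ , pψ , λ qψ → U , ψ , nU , qψ , Uψ⊆A

  -- Every member of p∼μ contains all the clopen sets U·ψ, so by compactness one of
  -- these already lies in V.
  open⇒prod : ∀ {V p} → Sμ.IsOpen V → V p →
              ∃₂ λ U ψ → Nbhd U × p ∋ ψ × (∀ q → q ∋ prod U ψ → V q)
  open⇒prod {V} {p} (V-resp , V-open) Vp =
    let (U , ψ , nU , pψ , c) = combine is in U , ψ , nU , pψ , λ q t → c q t (covers q)
    where
    -- `nothing` indexes V, and `just` the complement of one clopen set U·ψ.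
    I : Set ℓ
    I = Maybe (∃₂ λ U ψ → Nbhd U × p ∋ ψ)

    W : I → Pred (CompleteType γ) ℓ
    W nothing              q = V q
    W (just (U , ψ , _ , _)) q = Lift ℓ (q ∋ (¬′ prod U ψ))

    W-open : ∀ i → Topology.IsOpen (logicTopology γ) (W i)
    W-open nothing                = V-open
    W-open (just (U , ψ , _ , _)) = λ q (lift t) → ¬′ prod U ψ , t , lift

    W-cover : ∀ q → ∃[ i ] W i q
    W-cover q = byContradiction λ none → none (nothing , V-resp (near⇒∼ (prod∋⇒near
      λ {U} {ψ} nU pψ → [ id , (λ t → contradiction (just (U , ψ , nU , pψ) , lift t) none) ]′
        (∋⊎∋¬ q (prod U ψ)))) Vp)

    cover  = type-finiteSubcover lem ext W W-open W-cover
    is     = proj₁ cover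
    covers = proj₂ cover

    combine : ∀ is → ∃₂ λ U ψ → Nbhd U × p ∋ ψ ×
              (∀ q → q ∋ prod U ψ → Any (λ i → W i q) is → V q)
    combine [] = γ , γ , nbhd-γ , mem-δ p , λ _ _ ()
    combine (nothing ∷ is) = let (U , ψ , nU , pψ , c) = combine is in
      U , ψ , nU , pψ , λ { q t (here v) → v ; q t (there w) → c q t w }
    combine (just (U′ , ψ′ , nU′ , pψ′) ∷ is) = let (U , ψ , nU , pψ , c) = combine is in
      -- The product of the conjunctions lies in both products: the first rules out the complement
      -- at the head of the list, the second feeds the recursion.
      U′ ∧′ U , ψ′ ∧′ ψ , nbhd-∧ nU′ nU , ∋-∧ p pψ′ pψ , λ where
        q t (here (lift ¬t)) → contradiction (∋-upward q (⊩-prod-mono ⊩-∧ˡ ⊩-∧ˡ) t) (∋¬⇒∌ q ¬t)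
        q t (there w)        → c q (∋-upward q (⊩-prod-mono ⊩-∧ʳ ⊩-∧ʳ) t) w

  -- Failure of nearness gives U, ψ, θ with U·ψ disjoint from θ. If V⁻¹V lies in U, then V·ψ and V·θ
  -- are disjoint too, because ax = by implies (b⁻¹a)x = y.
  μ-hausdorff : Sμ.Hausdorff
  μ-hausdorff p q p≁q =
    let (U , ψ , θ , nU , pψ , qθ , apart) = witness
        (V , nV , V⁻¹V⊆U) = nbhd-quotient nU
    in Inner (_⊩ prod V ψ) , Inner (_⊩ prod V θ) ,
       inner-open (λ {g} {h} → ⊩-resp {g = g} {h}) , (V , ψ , nV , pψ , ⊩-prod⁺) ,
       inner-open (λ {g} {h} → ⊩-resp {g = g} {h}) , (V , θ , nV , qθ , ⊩-prod⁺) ,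
       λ { {r} ((_ , _ , n₁ , r₁ , sub₁) , (_ , _ , n₂ , r₂ , sub₂)) →
         let (z , s , t) = realise∧ r r₁ r₂
             (a , x , a⊩ , x⊩ , e) = ⊩-prod⁻ (sub₁ (ε⊩ n₁) s)
             (b , y , b⊩ , y⊩ , f) = ⊩-prod⁻ (sub₂ (ε⊩ n₂) t)
         in apart ((b ⁻¹) ∙ a) x (V⁻¹V⊆U b⊩ a⊩) x⊩
              (⊩-resp (sym (quotient-∙ {a} {x} {b} {y} (trans (sym e) f))) y⊩) }
    where
    witness : ∃ λ U → ∃₂ λ ψ θ → Nbhd U × p ∋ ψ × q ∋ θ × (∀ u x → u ⊩ U → x ⊩ ψ → ¬ u ∙ x ⊩ θ)
    witness = byContradiction λ none → p≁q (near⇒∼ (near λ nU pψ qθ → byContradiction λ apart →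
      none (_ , _ , _ , nU , pψ , qθ , λ u x u⊩ x⊩ ux⊩ → apart (u , x , u⊩ , x⊩ , ux⊩))))

  μ-compact : Sμ.IsCompact
  μ-compact = record
    { hausdorff      = μ-hausdorff
    ; finiteSubcover = λ V V-open → type-finiteSubcover lem ext V (λ i → proj₂ (V-open i))
    }

  rightShift-open : ∀ g {U} → Nbhd U → IsOpen (λ h → h ∙ (g ⁻¹) ⊩ U)
  rightShift-open g nU = rightTranslate-open (g ⁻¹) (isOpen nU)

  -- As h = (hg⁻¹)g, every h in Ug satisfies U·ψ once g satisfies ψ.
  χ-continuous : Continuous topology μTypeTopology (χ lem)
  χ-continuous V oV = open-local λ g Vg →
    let (U , ψ , nU , gψ , Uψ⊆V) = open⇒prod {V} {χ lem g} oV Vg in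
    (λ h → h ∙ (g ⁻¹) ⊩ U) , rightShift-open g nU ,
    ⊩-resp (sym (𝔾.inverseʳ g)) (ε⊩ nU) ,
    λ {h} s → Uψ⊆V (χ lem h) (χ-∋⁺ {h} (⊩-resp (𝔾ₚ.//-rightDividesˡ g h) (⊩-prod⁺ s (χ-∋⁻ gψ))))

  -- Nearness, tested on the formulas isolating g and h, gives h = ug with u as small as desired, so
  -- disjoint neighbourhoods of g and h are impossible.
  χ-injective : ∀ {g h} → χ lem g ∼μ χ lem h → g ≈ h
  χ-injective {g} {h} g∼h = byContradiction λ g≉h →
    let (V , W , oV , Vg , oW , Wh , V⊥W) = hausdorff g h g≉h
        (U , nU , Ug⊆V) = definableNbhd (rightTranslate-open g oV)
          (open-resp-≈ oV {g} {ε ∙ g} (sym (𝔾.identityˡ g)) Vg)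
        (u , x , u⊩ , x⊩ , ux⊩) = ∼⇒near g∼h .meet nU
          (χ-∋⁺ (from (⊩-point {g} g) refl)) (χ-∋⁺ (from (⊩-point {h} h) refl))
        ux≈ug = 𝔾.∙-congˡ {u} {x} {g} (to (⊩-point g) x⊩)
    in V⊥W (open-resp-≈ oV {u ∙ g} {h} (trans (sym ux≈ug) (to (⊩-point h) ux⊩)) (Ug⊆V u⊩) , Wh)

  -- Some Ug lies in V, and `point g` isolates g, so g passes to `Inner V`; the way back takes u =
  -- ε.
  χ-initial : ∀ V → IsOpen V → ∃[ W ] Sμ.IsOpen W × V ≐ (W ∘ χ lem)
  χ-initial V oV = Inner V , inner-open (λ {g} {h} → V-resp {g} {h}) , into , λ {g} → outof {g}
    where
    V-resp : V Respects _≈_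
    V-resp = open-resp-≈ oV

    into : ∀ {g} → V g → Inner V (χ lem g)
    into {g} Vg =
      let (U , nU , Ug⊆V) = definableNbhd (rightTranslate-open g oV)
            (V-resp {g} {ε ∙ g} (sym (𝔾.identityˡ g)) Vg)
      in U , point g , nU , χ-∋⁺ (from (⊩-point {g} g) refl) , λ {u} {x} u⊩ x⊩ →
           V-resp {u ∙ g} {u ∙ x} (𝔾.∙-congˡ {u} {g} {x} (sym (to (⊩-point g) x⊩))) (Ug⊆V u⊩)

    outof : ∀ {g} → Inner V (χ lem g) → V g
    outof {g} (U , ψ , nU , gψ , Uψ⊆V) = V-resp {ε ∙ g} {g} (𝔾.identityˡ g) (Uψ⊆V (ε⊩ nU) (χ-∋⁻ gψ))

  χ-embedding : IsEmbedding topology μTypeTopology (χ lem)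
  χ-embedding = record
    { congruent  = λ {g} {h} g≈h → ∋-mono⇒∼ λ {φ} t → χ-∋⁺ {h} {φ} (⊩-resp {g = g} {h} g≈h (χ-∋⁻ t))
    ; injective  = χ-injective
    ; continuous = χ-continuous
    ; initial    = χ-initial
    }

  χ-dense : Sμ.Dense (χ lem)
  χ-dense V (_ , V-open) (p , Vp) =
    let (φ , pφ , φ⊆V) = V-open p Vp
        (g , s)        = realise p pφ
    in g , φ⊆V (χ-∋⁺ {g} {φ} (sat s))

  •-cong : ∀ {g h p q} → g ≈ h → p ∼μ q → (g • p) ∼μ (h • q)
  •-cong {g} {h} {p} {q} g≈h p∼q = near⇒∼ (near λ nU pψ qθ →
    let (V , nV , V^g⊆U) = nbhd-conjugate g nU
        (v , x , v⊩ , x⊩ , vx⊩) = ∼⇒near p∼q .meet nV pψ qθ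
    in (g ∙ v) ∙ (g ⁻¹) , g ∙ x , V^g⊆U v⊩ , ⊩-translate⁻ x⊩ ,
       ⊩-resp (trans (𝔾.∙-congʳ {v ∙ x} {h} {g} (sym g≈h)) (sym (conjugate-∙ g v x)))
         (⊩-translate⁻ vx⊩))

  -- With W² inside U: if hg⁻¹ is in W and gx is in W·ψ, then hx = (hg⁻¹)(gx) is in W·(W·ψ), hence
  -- in U·ψ. The condition on gx defines the neighbourhood `Inner A` of p, where conjugation by g
  -- supplies the required small factor.
  •-continuous : Continuous (productTopology topology μTypeTopology) μTypeTopology (uncurry _•_)
  •-continuous V oV g p Vgp =
    let (U , ψ , nU , gpψ , Uψ⊆V) = open⇒prod {V} {g • p} oV Vgp
        (W , nW , W²⊆U)  = nbhd-square nU
        (W′ , nW′ , conj) = nbhd-conjugate g nW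
        A : Pred Carrier ℓ
        A = λ y → g ∙ y ⊩ prod W ψ
    in (λ h → h ∙ (g ⁻¹) ⊩ W) , Inner A ,
       rightShift-open g nW , ⊩-resp (sym (𝔾.inverseʳ g)) (ε⊩ nW) ,
       inner-open (λ {y} {z} y≈z → ⊩-resp {g = g ∙ y} {g ∙ z} (𝔾.∙-congˡ {g} {y} {z} y≈z)) ,
       (W′ , translate g ψ , nW′ , gpψ , λ {u} {x} u⊩ x⊩ →
         ⊩-resp (conjugate-∙ g u x) (⊩-prod⁺ (conj u⊩) (⊩-translate⁻ x⊩))) ,
       λ { {h} {q} h⊩ (_ , ξ , n , qξ , sub) → Uψ⊆V (h • q) (∋-upward q (λ {x} x⊩ →
         let (a , b , a⊩ , b⊩ , e) = ⊩-prod⁻ (sub (ε⊩ n) x⊩)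
             gx≈ab = trans (𝔾.∙-congˡ {g} {x} {ε ∙ x} (sym (𝔾.identityˡ x))) e
         in ⊩-translate⁺ (⊩-resp (sym (rebase g h {x} {a} {b} gx≈ab))
              (⊩-prod⁺ (W²⊆U h⊩ a⊩) b⊩))) qξ) }

  •-isGSpace : IsGSpace topologicalGroup μTypeTopology _•_
  •-isGSpace = record
    { •-cong     = λ {g} {h} → •-cong {g} {h}
    ; identity   = λ p → ∋-mono⇒∼ {ε • p} {p} (∋-upward p
        λ {x} s → ⊩-resp (𝔾.identityˡ x) (⊩-translate⁻ s))
    ; assoc      = λ g h p → ∋-mono⇒∼ {(g ∙ h) • p} {g • (h • p)} (∋-upward p
        λ {x} s → ⊩-translate⁺ (⊩-translate⁺ (⊩-resp (𝔾.assoc g h x) (⊩-translate⁻ s))))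
    ; continuous = •-continuous
    }

  χ-equivariant : ∀ g h → (g • χ lem h) ∼μ χ lem (g ∙ h)
  χ-equivariant g h = ∋-mono⇒∼ {g • χ lem h} {χ lem (g ∙ h)}
    λ {φ} t → χ-∋⁺ {g ∙ h} {φ} (⊩-translate⁻ (χ-∋⁻ {h} t))

-- Replacing parameters by variables, and definable families.

module Parameters {ℓ} {L : Language ℓ} {P : Set ℓ} where

  paramsᵗ : ∀ {n} → Term L P n → List P
  paramsᵗ (var i)    = []
  paramsᵗ (par c)    = c ∷ []
  paramsᵗ (fun f ts) = List.concat (List.tabulate (λ i → paramsᵗ (ts i)))

  paramsᶠ : ∀ {n} → Formula L P n → List P
  paramsᶠ (t == u)   = paramsᵗ t List.++ paramsᵗ u
  paramsᶠ (rel R ts) = List.concat (List.tabulate (λ i → paramsᵗ (ts i)))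
  paramsᶠ (¬′ φ)     = paramsᶠ φ
  paramsᶠ (φ ∧′ ψ)   = paramsᶠ φ List.++ paramsᶠ ψ
  paramsᶠ (∃′ φ)     = paramsᶠ φ

  ∈-params : ∀ {n k} (ts : Fin k → Term L P n) i {c} → c ∈ paramsᵗ (ts i) →
             c ∈ List.concat (List.tabulate (λ i → paramsᵗ (ts i)))
  ∈-params ts i c∈ = ∈-concat⁺′ c∈ (∈-tabulate⁺ i)

  -- κ assigns variables to occurrences of parameters, addressed by membership proofs, so parameters
  -- are never compared for equality.
  abstractᵗ : ∀ {m n} → (Fin n → Fin m) → (t : Term L P n) → (∀ {c} → c ∈ paramsᵗ t → Fin m) →
              Term L (⊥ₚ.⊥ {ℓ}) m
  abstractᵗ ρ (var i)    κ = var (ρ i)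
  abstractᵗ ρ (par c)    κ = var (κ (here refl))
  abstractᵗ ρ (fun f ts) κ = fun f λ i → abstractᵗ ρ (ts i) (κ ∘ ∈-params ts i)

  abstractᶠ : ∀ {m n} → (Fin n → Fin m) → (φ : Formula L P n) → (∀ {c} → c ∈ paramsᶠ φ → Fin m) →
              Formula L (⊥ₚ.⊥ {ℓ}) m
  abstractᶠ ρ (t == u)   κ = abstractᵗ ρ t (κ ∘ ∈-++⁺ˡ) == abstractᵗ ρ u (κ ∘ ∈-++⁺ʳ (paramsᵗ t))
  abstractᶠ ρ (rel R ts) κ = rel R λ i → abstractᵗ ρ (ts i) (κ ∘ ∈-params ts i)
  abstractᶠ ρ (¬′ φ)     κ = ¬′ abstractᶠ ρ φ κ
  abstractᶠ ρ (φ ∧′ ψ)   κ = abstractᶠ ρ φ (κ ∘ ∈-++⁺ˡ) ∧′ abstractᶠ ρ ψ (κ ∘ ∈-++⁺ʳ (paramsᶠ φ))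
  abstractᶠ ρ (∃′ φ)     κ = ∃′ abstractᶠ (Fin.lift 1 ρ) φ (suc ∘ κ)

module ParameterSemantics {ℓ} {L : Language ℓ} (𝓜 : Structure L) where
  open Structure 𝓜 renaming (Universe to M)
  open FirstOrder 𝓜
  open Parameters {L = L} {M}
  open Blocks 𝓜

  eval-abstract : ∀ {j m n} {v : Vec M j} {σ : Vec (Term L M j) m} {w : Vec M m} {u : Vec M n} →
    Vec.map (eval v) σ ≡ w → (ρ : Fin n → Fin m) → (∀ i → lookup w (ρ i) ≡ lookup u i) →
    ∀ t (κ : ∀ {c} → c ∈ paramsᵗ t → Fin m) → (∀ {c} (c∈ : c ∈ paramsᵗ t) → lookup w (κ c∈) ≡ c) →
    eval v (substᵗ ⊥ₚ.⊥-elim σ (abstractᵗ ρ t κ)) ≡ eval u t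
  eval-abstract {v = v} {σ} refl ρ hρ (var i) κ hκ =
    trans (sym (Vec.lookup-map (ρ i) (eval v) σ)) (hρ i)
  eval-abstract {v = v} {σ} refl ρ hρ (par c) κ hκ =
    trans (sym (Vec.lookup-map (κ (here refl)) (eval v) σ)) (hκ (here refl))
  eval-abstract e ρ hρ (fun f ts) κ hκ = cong ⟦ f ⟧ᶠ (Vec.tabulate-cong λ i →
    eval-abstract e ρ hρ (ts i) (κ ∘ ∈-params ts i) (hκ ∘ ∈-params ts i))

  -- The value w of σ is a separate argument, so that under a quantifier the induction hypothesis
  -- applies to the extended substitution with value `a ∷ w`.
  ⊨-abstract : ∀ {j m n} {v : Vec M j} {σ : Vec (Term L M j) m} {w : Vec M m} {u : Vec M n} →
    Vec.map (eval v) σ ≡ w → (ρ : Fin n → Fin m) → (∀ i → lookup w (ρ i) ≡ lookup u i) →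
    ∀ φ (κ : ∀ {c} → c ∈ paramsᶠ φ → Fin m) → (∀ {c} (c∈ : c ∈ paramsᶠ φ) → lookup w (κ c∈) ≡ c) →
    (v ⊨ substᶠ ⊥ₚ.⊥-elim σ (abstractᶠ ρ φ κ)) ⇔ (u ⊨ φ)
  ⊨-abstract e ρ hρ (t == s) κ hκ = mk⇔
    (λ eq → trans (sym et) (trans eq es)) (λ eq → trans et (trans eq (sym es)))
    where
    et = eval-abstract e ρ hρ t (κ ∘ ∈-++⁺ˡ) (hκ ∘ ∈-++⁺ˡ)
    es = eval-abstract e ρ hρ s (κ ∘ ∈-++⁺ʳ (paramsᵗ t)) (hκ ∘ ∈-++⁺ʳ (paramsᵗ t))
  ⊨-abstract e ρ hρ (rel R ts) κ hκ = mk⇔ (subst ⟦ R ⟧ʳ eq) (subst ⟦ R ⟧ʳ (sym eq))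
    where
    eq = Vec.tabulate-cong λ i →
      eval-abstract e ρ hρ (ts i) (κ ∘ ∈-params ts i) (hκ ∘ ∈-params ts i)
  ⊨-abstract e ρ hρ (¬′ φ) κ hκ = mk⇔ (_∘ from ih) (_∘ to ih)
    where ih = ⊨-abstract e ρ hρ φ κ hκ
  ⊨-abstract e ρ hρ (φ ∧′ ψ) κ hκ = mk⇔
    (λ (s , t) → to ihφ s , to ihψ t) (λ (s , t) → from ihφ s , from ihψ t)
    where
    ihφ = ⊨-abstract e ρ hρ φ (κ ∘ ∈-++⁺ˡ) (hκ ∘ ∈-++⁺ˡ)
    ihψ = ⊨-abstract e ρ hρ ψ (κ ∘ ∈-++⁺ʳ (paramsᶠ φ)) (hκ ∘ ∈-++⁺ʳ (paramsᶠ φ))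
  ⊨-abstract {v = v} {σ} {w} {u} e ρ hρ (∃′ φ) κ hκ = mk⇔
    (λ (a , s) → a , to (ih a) s) (λ (a , s) → a , from (ih a) s)
    where
    e′ : ∀ a → Vec.map (eval (a ∷ v)) (var zero ∷ Vec.map weaken σ) ≡ a ∷ w
    e′ a = cong (a ∷_) (trans (sym (Vec.map-∘ _ _ σ)) (trans (Vec.map-cong (eval-weaken a v) σ) e))

    ih : ∀ a → _
    ih a = ⊨-abstract {u = a ∷ u} (e′ a) (Fin.lift 1 ρ) (λ { zero → refl ; (suc i) → hρ i })
      φ (suc ∘ κ) hκ

  lookup-fromList-index : ∀ {c : M} {cs} (c∈ : c ∈ cs) → lookup (Vec.fromList cs) (Any.index c∈) ≡ c
  lookup-fromList-index (here refl) = refl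
  lookup-fromList-index (there c∈)  = lookup-fromList-index c∈

  -- The definition of a definable type only speaks about parameter-free formulas, so the
  -- parameters of Ψ are first turned into further variables and plugged in at the end.
  definable-family : ∀ {n m} {δ : Formulaᴹ n} (p : CompleteType δ) → IsDefinableType p →
    (Ψ : Formulaᴹ (n + m)) → ∃[ D ] ∀ (y : Vec M m) Φ →
      (∀ (x : Setoid.Carrier (Points δ)) → (proj₁ x ⊨ Φ) ⇔ (proj₁ x ++ y ⊨ Ψ)) →
      (y ⊨ D) ⇔ (p ∋ Φ)
  definable-family {n} {m} {δ} p p-definable Ψ = D , correct
    where
    open Types 𝓜
    k  = List.length (paramsᶠ Ψ)
    cs : Vec M k
    cs = Vec.fromList (paramsᶠ Ψ)

    -- The new variables form three blocks: those of the type, those of the family, and one for each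
    -- listed parameter; κ points into the last.
    ρ : Fin (n + m) → Fin (n + (m + k))
    ρ i = [ _↑ˡ (m + k) , (λ j → n ↑ʳ (j ↑ˡ k)) ]′ (splitAt n i)

    κ : ∀ {c} → c ∈ paramsᶠ Ψ → Fin (n + (m + k))
    κ c∈ = n ↑ʳ (m ↑ʳ Any.index c∈)

    lookup-ρ : ∀ (x : Vec M n) (y : Vec M m) i → lookup (x ++ (y ++ cs)) (ρ i) ≡ lookup (x ++ y) i
    lookup-ρ x y i = trans (split (splitAt n i)) (sym (Vec.lookup-splitAt n x y i))
      where
      split : ∀ s → lookup (x ++ (y ++ cs)) ([ _↑ˡ (m + k) , (λ j → n ↑ʳ (j ↑ˡ k)) ]′ s)
                  ≡ [ lookup x , lookup y ]′ s
      split (inj₁ j) = Vec.lookup-++ˡ x (y ++ cs) j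
      split (inj₂ j) = trans (Vec.lookup-++ʳ x (y ++ cs) (j ↑ˡ k)) (Vec.lookup-++ˡ y cs j)

    lookup-κ : ∀ (x : Vec M n) (y : Vec M m) {c} (c∈ : c ∈ paramsᶠ Ψ) →
               lookup (x ++ (y ++ cs)) (κ c∈) ≡ c
    lookup-κ x y c∈ = trans (Vec.lookup-++ʳ x (y ++ cs) (m ↑ʳ Any.index c∈))
      (trans (Vec.lookup-++ʳ y cs (Any.index c∈)) (lookup-fromList-index c∈))

    Ψ₀ : Formula L (⊥ₚ.⊥ {ℓ}) (n + (m + k))
    Ψ₀ = abstractᶠ ρ Ψ κ

    E     = proj₁ (p-definable {m + k} Ψ₀)
    E-def = proj₂ (p-definable {m + k} Ψ₀)

    σ : Vec M (m + k) → Vec (Term L M n) (n + (m + k))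
    σ a = vars n ++ Vec.map par a

    eval-σ : ∀ x a → Vec.map (eval x) (σ a) ≡ x ++ a
    eval-σ x a = trans (Vec.map-++ _ (vars n) _) (cong₂ _++_ (eval-vars x) (eval-params x a))

    D : Formulaᴹ m
    D = substᶠ id (vars m ++ Vec.map par cs) E

    eval-D : ∀ y → Vec.map (eval y) (vars m ++ Vec.map par cs) ≡ y ++ cs
    eval-D y = trans (Vec.map-++ _ (vars m) _) (cong₂ _++_ (eval-vars y) (eval-params y cs))

    correct : ∀ (y : Vec M m) Φ →
      (∀ (x : Setoid.Carrier (Points δ)) → (proj₁ x ⊨ Φ) ⇔ (proj₁ x ++ y ⊨ Ψ)) →
      (y ⊨ D) ⇔ (p ∋ Φ)
    correct y Φ Φ⇔Ψ = mk⇔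
      (λ s → ∋-mono p (λ x t → from (Φ⇔Ψ x) (to (inst x) t))
        (to (E-def (y ++ cs)) (to (⊨-substitute (eval-D y) E) s)))
      (λ t → from (⊨-substitute (eval-D y) E) (from (E-def (y ++ cs))
        (∋-mono p (λ x s → from (inst x) (to (Φ⇔Ψ x) s)) t)))
      where
      inst : ∀ (x : Setoid.Carrier (Points δ)) →
             (proj₁ x ⊨ substᶠ ⊥ₚ.⊥-elim (σ (y ++ cs)) Ψ₀) ⇔ (proj₁ x ++ y ⊨ Ψ)
      inst (x , _) = ⊨-abstract (eval-σ x (y ++ cs)) ρ (lookup-ρ x y) Ψ κ (lookup-κ x y)

-- Definable separability of the action.

module Separability (lem : ∀ {a} → ExcludedMiddle a) (ext : ∀ {a b} → Extensionality a b)
                    {ℓ} {L : Language ℓ} {𝓜 : Structure L} (G : DefinableTopologicalGroup 𝓜) where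
  open FirstOrder 𝓜
  open DefinableTopologicalGroup G
  open μTypes G
  open CompleteType using (mem-δ)
  open Types 𝓜
  open Blocks 𝓜
  open Infinitesimals G using (block₁; block₂; block₃)
  open ParameterSemantics 𝓜

  module _ {n} {δ : Formulaᴹ n} where
    module T = Topology (logicTopology δ)

    -- Each type in C₁ has a basic neighbourhood missing C₂. Together with the complement of C₁
    -- these cover the space, and θ is the disjunction over a finite subcover.
    clopen-separation : ∀ (C₁ C₂ : Pred (CompleteType δ) ℓ) → T.IsClosed C₁ → T.IsClosed C₂ → C₁ ⊥ C₂ →
                        ∃[ θ ] (∀ q → C₁ q → q ∋ θ) × (∀ q → C₂ q → ¬ q ∋ θ)
    clopen-separation C₁ C₂ o₁ o₂ C₁⊥C₂ =
      let (is , covers) = type-finiteSubcover lem ext W W-open W-cover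
          (θ , θ⊆ , ⊆θ) = disjunction is
      in θ , (λ q q∈C₁ → ⊆θ q q∈C₁ (covers q)) , λ q q∈C₂ qθ → θ⊆ q qθ q∈C₂
      where
      I : Set ℓ
      I = Maybe (∃[ φ ] ∀ q → q ∋ φ → ∁ C₂ q)

      W : I → Pred (CompleteType δ) ℓ
      W nothing        q = ∁ C₁ q
      W (just (φ , _)) q = Lift ℓ (q ∋ φ)

      W-open : ∀ i → T.IsOpen (W i)
      W-open nothing        = o₁
      W-open (just (φ , _)) = λ q (lift t) → φ , t , lift

      W-cover : ∀ q → ∃[ i ] W i q
      W-cover q with lem {P = C₁ q}
      ... | no  q∉C₁ = nothing , q∉C₁
      ... | yes q∈C₁ = let (φ , qφ , φ⊆) = o₂ q (λ q∈C₂ → C₁⊥C₂ (q∈C₁ , q∈C₂)) in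
        just (φ , λ r → φ⊆ {r}) , lift qφ

      disjunction : ∀ is → ∃[ θ ] (∀ q → q ∋ θ → ∁ C₂ q) × (∀ q → C₁ q → Any (λ i → W i q) is → q ∋ θ)
      -- The empty disjunction: no type on δ contains `¬′ δ`.
      disjunction [] = ¬′ δ , (λ q t → contradiction (mem-δ q) (∋¬⇒∌ q t)) , λ _ _ ()
      disjunction (nothing ∷ is) = let (θ , θ⊆ , ⊆θ) = disjunction is in
        θ , θ⊆ , λ { q c (here q∉C₁) → contradiction c q∉C₁ ; q c (there w) → ⊆θ q c w }
      disjunction (just (φ , φ⊆) ∷ is) = let (θ , θ⊆ , ⊆θ) = disjunction is in
        ¬′ (¬′ φ ∧′ ¬′ θ) ,
        (λ q t → [ φ⊆ q , (λ ¬φ → [ θ⊆ q , (λ ¬θ → contradiction (∋-∧ q ¬φ ¬θ) (∋¬⇒∌ q t)) ]′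
          (∋⊎∋¬ q θ)) ]′ (∋⊎∋¬ q φ)) ,
        λ { q c (here (lift t)) → ∋-mono q (λ _ s (¬s , _) → ¬s s) t
          ; q c (there w)       → ∋-mono q (λ _ s (_ , ¬s) → ¬s s) (⊆θ q c w) }

  opaque
    -- θ(g·x) with variables (x , g).
    translates : Formulaᴹ dim → Formulaᴹ (dim + dim)
    translates θ = ∃ⁿ dim (substᶠ id block₁ (γ ∧′ θ) ∧′ substᶠ id (block₃ ++ (block₂ ++ block₁)) mulᶠ)

    ⊨-translates : ∀ g x θ → (proj₁ x ++ proj₁ g ⊨ translates θ) ⇔ (proj₁ (g ∙ x) ⊨ θ)
    ⊨-translates g@(u , _) x@(v , _) θ = mk⇔ forward backward
      where
      eval-gxz : ∀ w → Vec.map (eval (w ++ (v ++ u))) (block₃ ++ (block₂ ++ block₁)) ≡ u ++ (v ++ w)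
      eval-gxz w = trans (Vec.map-++ _ block₃ _) (cong₂ _++_ (eval-third w v u)
        (trans (Vec.map-++ _ block₂ _) (cong₂ _++_ (eval-second w v u) (eval-first w v u))))

      forward : (v ++ u ⊨ translates θ) → proj₁ (g ∙ x) ⊨ θ
      forward s =
        let (w , s₁ , s₂) = to (⊨-∃ⁿ dim (v ++ u) _) s
            (γw , θw) = to (⊨-substitute (eval-first w v u) (γ ∧′ θ)) s₁
        in subst (_⊨ θ) (sym (to (mulᶠ-defines-∙ g x (w , γw)) (to (⊨-substitute (eval-gxz w) mulᶠ) s₂))) θw

      backward : proj₁ (g ∙ x) ⊨ θ → v ++ u ⊨ translates θ
      backward s = let w = proj₁ (g ∙ x) in from (⊨-∃ⁿ dim (v ++ u) _) (w ,
        from (⊨-substitute (eval-first w v u) (γ ∧′ θ)) (proj₂ (g ∙ x) , s) ,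
        from (⊨-substitute (eval-gxz w) mulᶠ) (from (mulᶠ-defines-∙ g x (g ∙ x)) refl))

  definablySeparable : (∀ (p : CompleteType γ) → IsDefinableType p) →
                       DefinablySeparableAction μTypeTopology _•_
  definablySeparable definable p C₁ C₂ (_ , o₁) (_ , o₂) C₁⊥C₂ =
    let (θ , C₁⊆θ , θ∩C₂) = clopen-separation C₁ C₂ o₁ o₂ C₁⊥C₂
        (D , D-def) = definable-family p (definable p) (translates θ)
        -- `translate g θ` has g as parameters and `translates θ` has it as variables; on G the two
        -- agree.
        D⇔ : ∀ g → (proj₁ g ⊨ D) ⇔ ((g • p) ∋ θ)
        D⇔ g = D-def (proj₁ g) (translate g θ) λ x → mk⇔
          (from (⊨-translates g x θ) ∘ to (⊨-translate g x θ))
          (from (⊨-translate g x θ) ∘ to (⊨-translates g x θ))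
    in (λ g → proj₁ g ⊨ D) , (λ g → proj₁ g ⊨ ¬′ D) , (D , λ _ → mk⇔ id id) ,
       (¬′ D , λ _ → mk⇔ id id) , (λ (s , ¬s) → ¬s s) ,
       (λ {g} c → from (D⇔ g) (C₁⊆θ (g • p) c)) ,
       λ {g} c s → θ∩C₂ (g • p) c (to (D⇔ g) s)

-- Extending orbit maps to the space of μ-types.

module Extension (lem : ∀ {a} → ExcludedMiddle a) (ext : ∀ {a b} → Extensionality a b)
                 {ℓ o} {L : Language ℓ} {𝓜 : Structure L} (G : DefinableTopologicalGroup 𝓜)
                 (C : Setoid ℓ ℓ) (TC : Topology C o)
                 (_·_ : DefinableTopologicalGroup.Carrier G → Setoid.Carrier C → Setoid.Carrier C)
                 (compact : Topology.IsCompact TC)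
                 (gspace : IsGSpace (DefinableTopologicalGroup.topologicalGroup G) TC _·_)
                 (c₀ : Setoid.Carrier C)
                 (separable : FirstOrder.DefinablySeparable 𝓜 (DefinableTopologicalGroup.γ G) TC
                                (λ g → g · c₀))
                 where
  open FirstOrder 𝓜
  open DefinableTopologicalGroup G using (γ; Carrier; _∙_)
  open μTypes G
  open CompleteType using (mem-δ)
  open Classical lem
  open Types 𝓜
  open Infinitesimals G
  open μSpace lem ext G using (χ-dense; ⊩-translate⁻)
  module C = Setoid C
  module TC = Topology TC
  open TC.IsCompact compact
  open TopologyProperties TC using (regular)
  open IsGSpace gspace

  orbit : Carrier → C.Carrier
  orbit g = g · c₀

  -- c is a cluster point of the filter generated by the images under `orbit` of the sets defined by
  -- formulas of q.
  record Cluster (q : CompleteType γ) (c : C.Carrier) : Set (lsuc ℓ ⊔ o) where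
    constructor clusters
    field
      visit : ∀ {V φ} → TC.IsOpen V → V c → q ∋ φ → ∃[ g ] g ⊩ φ × V (orbit g)

  open Cluster

  opaque
    -- Otherwise every c has a neighbourhood that the orbit avoids along some formula of q. Finitely
    -- many of these neighbourhoods cover C, yet a realisation of the conjoined formulas has its
    -- orbit point in none of them.
    cluster : ∀ q → ∃ (Cluster q)
    cluster q = byContradiction λ none → let
        Avoids : C.Carrier → Pred C.Carrier ℓ → Set _
        Avoids c V = TC.IsOpen V × V c × (∃[ φ ] q ∋ φ × (∀ g → g ⊩ φ → ¬ V (orbit g)))

        avoid : ∀ c → ∃ (Avoids c)
        avoid c = byContradiction λ na → none (c , clusters λ {V} {φ} oV Vc qφ →
          byContradiction λ nm → na (V , oV , Vc , φ , qφ , λ g g⊩ Vg → nm (g , g⊩ , Vg)))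

        V : C.Carrier → Pred C.Carrier ℓ
        V c = proj₁ (avoid c)

        (cs , covers) = finiteSubcover V (λ c → proj₁ (proj₂ (avoid c)))
                          (λ c → c , proj₁ (proj₂ (proj₂ (avoid c))))

        (φ , qφ , outside) = avoidAll V (λ c → proj₂ (proj₂ (proj₂ (avoid c)))) cs
        (g , g⊩φ) = realise q qφ
      in outside g (sat g⊩φ) (covers (orbit g))
      where
      avoidAll : ∀ (V : C.Carrier → Pred C.Carrier ℓ) →
                 (∀ c → ∃[ φ ] q ∋ φ × (∀ g → g ⊩ φ → ¬ V c (orbit g))) → ∀ cs →
                 ∃[ φ ] q ∋ φ × (∀ g → g ⊩ φ → ¬ Any (λ c → V c (orbit g)) cs)
      avoidAll V av [] = γ , mem-δ q , λ _ _ ()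
      avoidAll V av (c ∷ cs) =
        let (φ , qφ , out) = av c
            (ψ , qψ , outs) = avoidAll V av cs
        in φ ∧′ ψ , ∋-∧ q qφ qψ , λ where
          g s (here v)  → out g (⊩-∧ˡ s) v
          g s (there v) → outs g (⊩-∧ʳ s) v

  -- Regularity makes the complements of W and V disjoint closed sets, so some φ separates their
  -- preimages. Were `¬′ φ` in q, the orbit would visit N outside φ, although N misses W. Hence φ is
  -- in q, and φ excludes the complement of V.
  cluster-limit : ∀ {q c V} → Cluster q c → TC.IsOpen V → V c →
                  ∃[ φ ] q ∋ φ × (∀ {g} → g ⊩ φ → V (orbit g))
  cluster-limit {q} {c} {V} q↝c oV Vc with regular lem compact oV Vc
  ... | N , W , oN , Nc , oW , N⊥W , V∪W
    with separable (∁ W) (∁ V) (closed oW) (closed oV) (λ {z} (¬w , ¬v) → [ ¬v , ¬w ]′ (V∪W z))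
    where
    closed : ∀ {V} → TC.IsOpen V → TC.IsClosed (∁ V)
    closed oV = TC.open-resp-≐ ((λ v ¬v → ¬v v) , byContradiction) oV
  ... | D₁ , D₂ , (φ , φ-def) , _ , D₁⊥D₂ , ⊆D₁ , ⊆D₂ with ∋⊎∋¬ q φ
  ...   | inj₁ qφ  = φ , qφ , λ {g} (sat s) → byContradiction λ ¬v →
          D₁⊥D₂ (to (φ-def g) s , ⊆D₂ {g} ¬v)
  ...   | inj₂ q¬φ = let (g , sat ¬s , n) = q↝c .visit oN Nc q¬φ in
          contradiction (from (φ-def g) (⊆D₁ {g} (λ w → N⊥W (n , w)))) ¬s

  cluster-unique : ∀ {q c d} → Cluster q c → Cluster q d → c C.≈ d
  cluster-unique {q} {c} {d} q↝c q↝d = byContradiction λ c≉d →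
    let (V , W , oV , Vc , oW , Wd , V⊥W) = hausdorff c d c≉d
        (φ , qφ , φ⊆V) = cluster-limit q↝c oV Vc
        (g , g⊩ , w)   = q↝d .visit oW Wd qφ
    in V⊥W (φ⊆V g⊩ , w)

  -- Continuity at (ε , c) gives A and B with A·B inside V. Nearness realises each formula of r by
  -- some ux with u in A and the orbit point of x in B.
  cluster-resp-∼ : ∀ {q r c} → q ∼μ r → Cluster q c → Cluster r c
  cluster-resp-∼ {q} {r} {c} q∼r q↝c .visit {V} oV Vc rφ =
    let (A , B , oA , Aε , oB , Bc , AB⊆V) =
          continuous V oV _ c (TC.open-resp-≈ oV (C.sym (identity c)) Vc)
        (U , nU , U⊆A) = definableNbhd oA Aε
        (ψ , qψ , ψ⊆B) = cluster-limit q↝c oB Bc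
        (u , x , u⊩ , x⊩ , ux⊩) = ∼⇒near q∼r .meet nU qψ rφ
    in u ∙ x , ux⊩ , TC.open-resp-≈ oV (C.sym (assoc u x c₀)) (AB⊆V (U⊆A u⊩) (ψ⊆B x⊩))

  cluster-• : ∀ {q c} g → Cluster q c → Cluster (g • q) (g · c)
  cluster-• g q↝c .visit {V} oV Vgc gqφ =
    let (x , x⊩ , v) = q↝c .visit (continuous-sectionʳ {TX = DefinableTopologicalGroup.topology G} {TC} {TC}
                              {_·_} continuous g V oV) Vgc gqφ
    in g ∙ x , ⊩-translate⁻ x⊩ , TC.open-resp-≈ oV (C.sym (assoc g x c₀)) v

  cluster-χ : ∀ g → Cluster (χ lem g) (orbit g)
  cluster-χ g .visit oV Vg gφ = g , sat (⌜⌝⁻ gφ) , Vg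

  limit : CompleteType γ → C.Carrier
  limit q = proj₁ (cluster q)

  -- If r contains a formula whose orbit stays in N, its cluster point cannot lie in W, which is
  -- disjoint from N; so it lies in V.
  limit-continuous : Continuous μTypeTopology TC limit
  limit-continuous V oV =
    (λ {q} {r} q∼r → TC.open-resp-≈ oV
      (cluster-unique (cluster-resp-∼ q∼r (proj₂ (cluster q))) (proj₂ (cluster r)))) ,
    λ q Vq →
      let (N , W , oN , Nq , oW , N⊥W , V∪W) = regular lem compact oV Vq
          (φ , qφ , φ⊆N) = cluster-limit (proj₂ (cluster q)) oN Nq
      in φ , qφ , λ {r} rφ → [ id , (λ w →
           let (g , g⊩ , w′) = proj₂ (cluster r) .visit oW w rφ
           in contradiction (φ⊆N g⊩ , w′) N⊥W) ]′ (V∪W (limit r))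

  dense-determines : (F F′ : CompleteType γ → C.Carrier) →
                     Continuous μTypeTopology TC F → Continuous μTypeTopology TC F′ →
                     (∀ g → F (χ lem g) C.≈ F′ (χ lem g)) → ∀ q → F q C.≈ F′ q
  dense-determines F F′ F-cont F′-cont agree q = byContradiction λ Fq≉F′q →
    let (V , W , oV , VF , oW , WF′ , V⊥W) = hausdorff (F q) (F′ q) Fq≉F′q
        (g , v , w) = χ-dense ((V ∘ F) ∩ (W ∘ F′))
          (Topology.open-∩ μTypeTopology {V ∘ F} {W ∘ F′} (F-cont V oV) (F′-cont W oW))
          (q , VF , WF′)
    in V⊥W (TC.open-resp-≈ oV (agree g) v , w)

  extension : ∃! {A = Func μTypeSetoid C}
                 (λ F F′ → ∀ q → Func.to F q C.≈ Func.to F′ q)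
                 (λ F → Continuous μTypeTopology TC (Func.to F)
                      × (∀ g q → Func.to F (g • q) C.≈ (g · Func.to F q))
                      × (∀ g → Func.to F (χ lem g) C.≈ orbit g))
  extension =
    record
      { to   = limit
      ; cong = λ {q} {r} q∼r →
          cluster-unique (cluster-resp-∼ q∼r (proj₂ (cluster q))) (proj₂ (cluster r))
      } ,
    ( limit-continuous
    , (λ g q → cluster-unique (proj₂ (cluster (g • q))) (cluster-• g (proj₂ (cluster q))))
    , limit-χ ) ,
    λ {F} (F-cont , _ , F-χ) → dense-determines limit (Func.to F) limit-continuous F-cont
      λ g → C.trans (limit-χ g) (C.sym (F-χ g))
    where
    limit-χ : ∀ g → limit (χ lem g) C.≈ orbit g
    limit-χ g = cluster-unique (proj₂ (cluster (χ lem g))) (cluster-χ g)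

theoremA15 :
  (lem : ∀ {a} → ExcludedMiddle a) → (ext : ∀ {a b} → Extensionality a b) →
  ∀ {ℓ o} {L : Language ℓ} (𝓜 : Structure L) (G : DefinableTopologicalGroup 𝓜) →
  let open FirstOrder 𝓜
      open DefinableTopologicalGroup G
      open μTypes G
  in
  (Topology.IsCompact μTypeTopology
    × IsEmbedding topology μTypeTopology (χ lem)
    × Topology.Dense μTypeTopology (χ lem)
    × IsGSpace topologicalGroup μTypeTopology _•_
    × (∀ g h → (g • χ lem h) ∼μ χ lem (g ∙ h)))
  ×
  ((∀ (p : CompleteType γ) → IsDefinableType p) → DefinablySeparableAction μTypeTopology _•_)
  ×
  (∀ (C : Setoid ℓ ℓ) (TC : Topology C o) →
     let module C = Setoid C in
     (_·_ : Carrier → C.Carrier → C.Carrier) →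
     Topology.IsCompact TC → IsGSpace topologicalGroup TC _·_ →
     (p : C.Carrier) →
     DefinablySeparable γ TC (λ g → g · p) →
     ∃! {A = Func μTypeSetoid C}
        (λ F F′ → ∀ q → Func.to F q C.≈ Func.to F′ q)
        (λ F → Continuous μTypeTopology TC (Func.to F)
             × (∀ g q → Func.to F (g • q) C.≈ (g · Func.to F q))
             × (∀ g → Func.to F (χ lem g) C.≈ (g · p))))
theoremA15 lem ext 𝓜 G =
  (μ-compact , χ-embedding , χ-dense , •-isGSpace , χ-equivariant) ,
  Separability.definablySeparable lem ext G ,
  Extension.extension lem ext G
  where open μSpace lem ext G
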